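{- Let $\mathbf{k}=(k_1,\dots,k_t)$, $\mathbf{n}=(n_1,\dots,n_t)$ with $k_i<n_i\le m$ for all $i\in\{1,\dots,t\}$, $N=\sum_in_i$, $K=\sum_ik_i$, and let $\mathcal{C}\subseteq\mathbb{F}_{q^m}^N$ be an $[N,K]_{q^m/q}$ code. Then $\mathcal{C}$ is an $(\mathbf{n},\mathbf{k})$-MRD code if and only if $\mathcal{C}^\perp$ is an $(\mathbf{n},\mathbf{n}-\mathbf{k})$-MRD code, where $\mathbf{n}-\mathbf{k}=(n_1-k_1,\dots,n_t-k_t)$.
   Context: An $[n,k]_{q^m/q}$ code is a $k$-dim $\mathbb{F}_{q^m}$-subspace of $\mathbb{F}_{q^m}^n$ with rank weight $w(v)=\dim_{\mathbb{F}_q}\langle v_1,\dots,v_n\rangle_{\mathbb{F}_q}$; $\mathcal{C}^\perp$ is its dual w.r.t. the standard bilinear form $\sum_ix_iy_i$. For $n_i\le m$, an $[n_i,k_i]_{q^m/q}$ code is MRD if its minimum distance is $n_i-k_i+1$. For $\mathbf{a}=(a_1,\dots,a_t)$ with $a_i<n_i$ and $A=\sum a_i$, an $[N,A]_{q^m/q}$ code $\mathcal{C}$ is an $(\mathbf{n},\mathbf{a})$-MRD code if $\mathcal{C}=\mathcal{C}_1\oplus\dots\oplus\mathcal{C}_t=\{(c_1,\dots,c_t):c_i\in\mathcal{C}_i\}$ (coordinates split into consecutive blocks of lengths $n_1,\dots,n_t$) for MRD codes $\mathcal{C}_i$ of parameters $[n_i,a_i]_{q^m/q}$, and every codeword $(c_1,\dots,c_t)$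 with all $c_i\ne0$ has rank weight at least $N-A+1$. -}

module Defs where

open import Level using (0ℓ)
open import Algebra.Bundles using (CommutativeRing)
open import Data.Nat as ℕ using (ℕ; zero; suc; _∸_) renaming (_+_ to _+ℕ_; _≤_ to _≤ℕ_; _<_ to _<ℕ_)
open import Data.Fin using (Fin; zero; suc; _↑ˡ_; _↑ʳ_)
open import Data.Vec using (Vec; []; _∷_; lookup; sum)
open import Data.Product using (Σ; ∃; _×_; _,_)
open import Data.Sum using (_⊎_)
open import Relation.Nullary using (¬_)
open import Data.Unit using (⊤)
open import Relation.Binary.PropositionalEquality using (_≡_)

record Field : Set₁ where
  field
    ring : CommutativeRing 0ℓ 0ℓ
  open CommutativeRing ring public hiding (ring)
  field
    0≉1     : ¬ (0# ≈ 1#)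
    inverse : ∀ x → ¬ (x ≈ 0#) → ∃ λ y → x * y ≈ 1#

-- Consecutive blocks of coordinates: for n = (n₁,…,n_t), the j-th
-- coordinate of the i-th block of a vector of length n₁+⋯+n_t.

embed : ∀ {t} (n : Vec ℕ t) (i : Fin t) → Fin (lookup n i) → Fin (sum n)
embed (a ∷ n) zero    j = j ↑ˡ sum n
embed (a ∷ n) (suc i) j = a ↑ʳ embed n i j

module FieldExtension (L : Field) (F : Field.Carrier L → Set) where
  open Field L hiding (zero)

  Vect : ℕ → Set
  Vect r = Fin r → Carrier

  _≈ᵥ_ : ∀ {r} → Vect r → Vect r → Set
  x ≈ᵥ y = ∀ j → x j ≈ y j

  0ᵥ : ∀ {r} → Vect r
  0ᵥ _ = 0#

  _+ᵥ_ : ∀ {r} → Vect r → Vect r → Vect r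
  (x +ᵥ y) j = x j + y j

  _·ᵥ_ : ∀ {r} → Carrier → Vect r → Vect r
  (a ·ᵥ x) j = a * x j

  block : ∀ {t} (n : Vec ℕ t) → Vect (sum n) → (i : Fin t) → Vect (lookup n i)
  block n x i j = x (embed n i j)

  module Lin {V : Set} (_≈V_ : V → V → Set) (0V : V) (_+V_ : V → V → V)
             (_·V_ : Carrier → V → V) (S : Carrier → Set) where

    lincomb : ∀ {d} → (Fin d → Carrier) → (Fin d → V) → V
    lincomb {zero}  c v = 0V
    lincomb {suc d} c v = (c zero ·V v zero) +V lincomb (λ j → c (suc j)) (λ j → v (suc j))

    Scalars : ∀ {d} → (Fin d → Carrier) → Set
    Scalars c = ∀ j → S (c j)

    LinIndep : ∀ {d} → (Fin d → V) → Set
    LinIndep v = ∀ c → Scalars c → lincomb c v ≈V 0V → ∀ j → c j ≈ 0#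

    IsBasis : ∀ {d} → (V → Set) → (Fin d → V) → Set
    IsBasis W v = (∀ j → W (v j)) × LinIndep v
                  × (∀ w → W w → ∃ λ c → Scalars c × (w ≈V lincomb c v))

    HasDim : (V → Set) → ℕ → Set
    HasDim W d = ∃ λ (v : Fin d → V) → IsBasis W v

  module LinF = Lin _≈_ 0# _+_ _*_ F
  module LinL (r : ℕ) = Lin (_≈ᵥ_ {r}) 0ᵥ _+ᵥ_ _·ᵥ_ (λ _ → ⊤)

  SpanF : ∀ {r} → Vect r → Carrier → Set
  SpanF x a = ∃ λ c → LinF.Scalars c × (a ≈ LinF.lincomb c x)

  HasRankWeight : ∀ {r} → Vect r → ℕ → Set
  HasRankWeight x w = LinF.HasDim (SpanF x) w

  Code : ℕ → Set₁
  Code r = Vect r → Set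

  record IsCode {r} (C : Code r) (k : ℕ) : Set where
    field
      resp  : ∀ x y → x ≈ᵥ y → C x → C y
      zero∈ : C 0ᵥ
      +∈    : ∀ x y → C x → C y → C (x +ᵥ y)
      ·∈    : ∀ a x → C x → C (a ·ᵥ x)
      dim   : LinL.HasDim r C k

  NonZero : ∀ {r} → Vect r → Set
  NonZero x = ¬ (x ≈ᵥ 0ᵥ)

  dot : ∀ {r} → Vect r → Vect r → Carrier
  dot {zero}  x y = 0#
  dot {suc r} x y = (x zero * y zero) + dot (λ j → x (suc j)) (λ j → y (suc j))

  dual : ∀ {r} → Code r → Code r
  dual C y = ∀ x → C x → dot x y ≈ 0#

  HasMinDist : ∀ {r} → Code r → ℕ → Set
  HasMinDist C d =
    (∀ x → C x → NonZero x → ∀ w → HasRankWeight x w → d ≤ℕ w)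
    × (∃ λ x → C x × NonZero x × HasRankWeight x d)

  -- MRD: an [r,k] code (r ≤ m) with minimum distance r - k + 1
  IsMRD : ∀ {r} → Code r → ℕ → Set
  IsMRD {r} C k = IsCode C k × HasMinDist C (suc (r ∸ k))

  IsBlockMRD : ∀ {t} (n a : Vec ℕ t) → Code (sum n) → Set₁
  IsBlockMRD {t} n a C =
    (∀ i → lookup a i <ℕ lookup n i)
    × IsCode C (sum a)
    × (∃ λ (Cs : (i : Fin t) → Code (lookup n i)) →
         (∀ i → IsMRD (Cs i) (lookup a i))
         × (∀ x → (C x → ∀ i → Cs i (block n x i))
                × ((∀ i → Cs i (block n x i)) → C x))
         × (∀ x → C x → (∀ i → NonZero (block n x i))
                → ∀ w → HasRankWeight x w → suc (sum n ∸ sum a) ≤ℕ w))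

record IsSubfield (L : Field) (F : Field.Carrier L → Set) : Set where
  open Field L hiding (zero)
  field
    resp  : ∀ x y → x ≈ y → F x → F y
    0∈    : F 0#
    1∈    : F 1#
    +∈    : ∀ x y → F x → F y → F (x + y)
    -∈    : ∀ x → F x → F (- x)
    *∈    : ∀ x y → F x → F y → F (x * y)
    inv∈  : ∀ x y → F x → x * y ≈ 1# → F y

HasCard : (L : Field) (F : Field.Carrier L → Set) → ℕ → Set
HasCard L F q =
  ∃ λ (e : Fin q → Carrier) → (∀ j → F (e j))
    × (∀ i j → e i ≈ e j → i ≡ j)
    × (∀ x → F x → ∃ λ j → x ≈ e j)
  where open Field L

record IsExtension (L : Field) (F : Field.Carrier L → Set) (q m : ℕ) : Set where
  open Field L hiding (zero)
  field
    subfield : IsSubfield L F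
    card     : HasCard L F q
    degree   : FieldExtension.LinF.HasDim L F (λ _ → ⊤) m

{-# OPTIONS --safe #-}

-- For a set J of blocks write N_J, K_J for the sums of the nᵢ, kᵢ over i ∈ J. The block MRD
-- property of C = ⊕ Cᵢ is equivalent to: every nonzero c ∈ C whose nonzero blocks are exactly
-- those in J has weight at least N_J − K_J + 1. (A zero block can be filled with a minimum weight
-- word of Cᵢ, scaled so that the two spans meet; this raises the weight by at most nᵢ − kᵢ.)
--
-- This property passes to the dual, by induction on the support J of y ∈ C^⊥. Suppose
-- w(y) ≤ K_J. The vectors over F supported on J and orthogonal to y contain N_J − K_J independent
-- ones; over L these, together with a basis of C_J, are N_J vectors orthogonal to y ≠ 0, so they
-- are dependent. This gives a nonzero c ∈ C of weight at most N_J − K_J, whose support J′ is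
-- therefore strictly smaller than J. As c lies in the L-span of the F-relations of y,
-- w(c) + w(y|J′) ≤ N_J′, and induction gives w(y|J′) ≥ K_J′ + 1, contradicting
-- w(c) ≥ N_J′ − K_J′ + 1.

module Submission where

open import Defs
open import Level using (0ℓ)
import Algebra.Properties.CommutativeMonoid.Sum
import Algebra.Properties.Semiring.Sum
open import Algebra.Bundles using (CommutativeMonoid; CommutativeRing)
open import Data.Bool as Bool using (Bool; true; false; if_then_else_; not; _∨_)
import Data.Bool.Properties as Boolₚ
open import Data.Empty using (⊥; ⊥-elim)
open import Data.Nat as ℕ using (ℕ; zero; suc; pred; _≤_; _<_; _∸_; z≤n; s≤s)
import Data.Nat.Properties as ℕₚ
open import Data.Fin as Fin using (Fin; zero; suc; _↑ˡ_; _↑ʳ_; punchIn; splitAt)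
import Data.Fin.Properties as Finₚ
open import Data.Product using (∃; _×_; _,_; proj₁; proj₂)
open import Data.Sum using (_⊎_; inj₁; inj₂; [_,_]′)
open import Data.Unit using (⊤; tt)
open import Data.Vec using (Vec; []; _∷_; lookup; sum; zipWith)
open import Data.Vec.Functional using (Vector; insertAt; _++_)
import Data.Vec.Properties as Vecₚ
import Data.Vec.Functional as Vector
import Data.Vec.Functional.Properties as Vectorₚ
open import Function using (_∘_)
open import Relation.Nullary using (¬_; Dec; yes; no; does; contradiction)
open import Relation.Nullary.Decidable using (¬?; _×-dec_)
open import Relation.Binary using (Decidable)
open import Relation.Binary.PropositionalEquality as ≡ using (_≡_; _≢_)

-- The inequality w(c) + w(y|J′) ≤ N_J′ is really a statement over F. Expand both vectors in F-bases
-- of their spans; that c is orthogonal, over L, to every column of the coefficient matrix of y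
-- becomes orthogonality of two subspaces of a vector space over F, because the basis of c is
-- F-independent. Orthogonality of c and y alone would not give this, which is why c is sought in
-- the L-span of the F-relations of y and not merely in C. The obstacle is that the elimination
-- producing c does not control its support, while the definition bounds only words without zero
-- blocks. Hence the bound is first extended to every support, and the induction runs over supports.
-- Cutting y down to J′ stays inside the dual because each generator of C can be chosen inside a
-- single block. Duality of ordinary MRD codes is not quoted: it is the same argument with one
-- block. Supports, spans and ranks have to be computed, so equality in L and membership in F-spans
-- are decided; finiteness of F and of the degree provides this.

module FiniteSums (M : CommutativeMonoid 0ℓ 0ℓ) where
  open CommutativeMonoid M renaming (_∙_ to _+_; ε to 0#; ∙-cong to +-cong; ∙-congˡ to +-congˡ; ∙-congʳ to +-congʳ; identityˡ to +-identityˡ; identityʳ to +-identityʳ; assoc to +-assoc)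
  private module Sum = Algebra.Properties.CommutativeMonoid.Sum M

  -- Opaque, so that unification can read the summand off a sum.
  opaque
    ∑ : ∀ {n} → Vector Carrier n → Carrier
    ∑ = Sum.sum

    ∑-empty : (f : Vector Carrier 0) → ∑ f ≈ 0#
    ∑-empty f = refl

    ∑-suc : ∀ {n} (f : Vector Carrier (suc n)) → ∑ f ≈ f zero + ∑ (f ∘ suc)
    ∑-suc f = refl

    ∑-cong : ∀ {n} {f g : Vector Carrier n} → (∀ i → f i ≈ g i) → ∑ f ≈ ∑ g
    ∑-cong = Sum.sum-cong-≋

    ∑-remove : ∀ {n} (f : Vector Carrier (suc n)) i → ∑ f ≈ f i + ∑ (λ j → f (punchIn i j))
    ∑-remove f i = Sum.sum-remove {i = i} f

    ∑-distrib-+ : ∀ {n} (f g : Vector Carrier n) → ∑ (λ i → f i + g i) ≈ ∑ f + ∑ g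
    ∑-distrib-+ = Sum.∑-distrib-+

    ∑-comm : ∀ {m n} (f : Fin m → Fin n → Carrier) → ∑ (λ i → ∑ (f i)) ≈ ∑ (λ j → ∑ (λ i → f i j))
    ∑-comm = Sum.∑-comm

    ∑-0# : ∀ n → ∑ {n} (λ _ → 0#) ≈ 0#
    ∑-0# = Sum.sum-replicate-zero

  ∑-zero : ∀ {n} {f : Vector Carrier n} → (∀ i → f i ≈ 0#) → ∑ f ≈ 0#
  ∑-zero {n} f≈0 = trans (∑-cong f≈0) (∑-0# n)

  ∑-single : ∀ {n} (f : Vector Carrier n) k → (∀ i → i ≢ k → f i ≈ 0#) → ∑ f ≈ f k
  ∑-single {suc n} f k off = begin
    ∑ f                          ≈⟨ ∑-remove f k ⟩
    f k + ∑ (λ i → f (punchIn k i)) ≈⟨ +-congˡ (∑-zero λ i → off _ (Finₚ.punchInᵢ≢i k i)) ⟩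
    f k + 0#                     ≈⟨ +-identityʳ _ ⟩
    f k                          ∎
    where open import Relation.Binary.Reasoning.Setoid setoid

  ∑-split : ∀ m {n} (f : Vector Carrier (m ℕ.+ n)) → ∑ f ≈ ∑ (λ i → f (i ↑ˡ n)) + ∑ (λ i → f (m ↑ʳ i))
  ∑-split zero    f = sym (trans (+-congʳ (∑-empty _)) (+-identityˡ _))
  ∑-split (suc m) {n} f = begin
    ∑ f                                                        ≈⟨ ∑-suc f ⟩
    f zero + ∑ (f ∘ suc)                                       ≈⟨ +-congˡ (∑-split m (f ∘ suc)) ⟩
    f zero + (∑ (λ i → f (suc (i ↑ˡ n))) + ∑ (λ i → f (suc (m ↑ʳ i)))) ≈⟨ +-assoc _ _ _ ⟨
    f zero + ∑ (λ i → f (suc (i ↑ˡ n))) + ∑ (λ i → f (suc (m ↑ʳ i)))   ≈⟨ +-congʳ (∑-suc (λ i → f (i ↑ˡ n))) ⟨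
    ∑ (λ i → f (i ↑ˡ n)) + ∑ (λ i → f (suc m ↑ʳ i))            ∎
    where open import Relation.Binary.Reasoning.Setoid setoid

  ∑-embed : ∀ {t} (n : Vec ℕ t) (f : Vector Carrier (sum n)) → ∑ f ≈ ∑ (λ i → ∑ (λ j → f (embed n i j)))
  ∑-embed []      f = trans (∑-empty f) (sym (∑-empty _))
  ∑-embed (a ∷ n) f = trans (∑-split a f) (trans (+-congˡ (∑-embed n (λ i → f (a ↑ʳ i)))) (sym (∑-suc (λ i → ∑ (λ j → f (embed (a ∷ n) i j))))))

-- Counting and enumerating decidable subsets

count : ∀ {n} → (Fin n → Bool) → ℕ
count {zero}  P = 0
count {suc n} P = if P zero then suc (count (P ∘ suc)) else count (P ∘ suc)

record Enumeration {n} (P : Fin n → Bool) (c : ℕ) : Set where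
  field
    ι           : Fin c → Fin n
    ι-true      : ∀ i → P (ι i) ≡ true
    ι-injective : ∀ {i j} → ι i ≡ ι j → i ≡ j
    ι-onto      : ∀ j → P j ≡ true → ∃ λ i → ι i ≡ j

enumerate : ∀ {n} (P : Fin n → Bool) → Enumeration P (count P)
enumerate {zero}  P = record { ι = λ () ; ι-true = λ () ; ι-injective = λ { {()} } ; ι-onto = λ () }
enumerate {suc n} P with P zero in P₀ | enumerate (P ∘ suc)
... | true  | en = record
  { ι           = λ { zero → zero ; (suc i) → suc (ι i) }
  ; ι-true      = λ { zero → P₀ ; (suc i) → ι-true i }
  ; ι-injective = λ { {zero} {zero} _ → ≡.refl ; {suc i} {suc j} eq → ≡.cong suc (ι-injective (Finₚ.suc-injective eq)) }
  ; ι-onto      = λ { zero _ → zero , ≡.refl ; (suc j) Pj → let (i , eq) = ι-onto j Pj in suc i , ≡.cong suc eq }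
  }
  where open Enumeration en
... | false | en = record
  { ι           = suc ∘ ι
  ; ι-true      = ι-true
  ; ι-injective = ι-injective ∘ Finₚ.suc-injective
  ; ι-onto      = λ { zero P₀-true → contradiction (≡.trans (≡.sym P₀-true) P₀) λ () ; (suc j) Pj → let (i , eq) = ι-onto j Pj in i , ≡.cong suc eq }
  }
  where open Enumeration en

count-cong : ∀ {n} {P Q : Fin n → Bool} → (∀ i → P i ≡ Q i) → count P ≡ count Q
count-cong {zero}  P≗Q = ≡.refl
count-cong {suc n} P≗Q rewrite P≗Q zero | count-cong (P≗Q ∘ suc) = ≡.refl

count-true : ∀ {n} {P : Fin n → Bool} → (∀ i → P i ≡ true) → count P ≡ n
count-true {zero}  P-true = ≡.refl
count-true {suc n} P-true rewrite P-true zero = ≡.cong suc (count-true (P-true ∘ suc))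

count-mono-≤ : ∀ {n} {P Q : Fin n → Bool} → (∀ i → P i ≡ true → Q i ≡ true) → count P ≤ count Q
count-mono-≤ {zero} P⊆Q = z≤n
count-mono-≤ {suc n} {P} {Q} P⊆Q with P zero | Q zero | P⊆Q zero | count-mono-≤ (P⊆Q ∘ suc)
... | true  | true  | _  | le = s≤s le
... | false | true  | _  | le = ℕₚ.m≤n⇒m≤1+n le
... | false | false | _  | le = le
... | true  | false | P₀ | _  = contradiction (P₀ ≡.refl) λ ()

count-mono-< : ∀ {n} {P Q : Fin n → Bool} → (∀ i → P i ≡ true → Q i ≡ true) →
               ∀ k → P k ≡ false → Q k ≡ true → count P < count Q
count-mono-< P⊆Q zero P₀ Q₀ rewrite P₀ | Q₀ = s≤s (count-mono-≤ (P⊆Q ∘ suc))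
count-mono-< {P = P} {Q} P⊆Q (suc k) Pk Qk with P zero | Q zero | P⊆Q zero | count-mono-< (P⊆Q ∘ suc) k Pk Qk
... | true  | true  | _  | lt = s≤s lt
... | false | true  | _  | lt = ℕₚ.m≤n⇒m≤1+n lt
... | false | false | _  | lt = lt
... | true  | false | P₀ | _  = contradiction (P₀ ≡.refl) λ ()

-- Linear algebra over a field and a subfield

module LinearAlgebra (L : Field) (_≟_ : Decidable (Field._≈_ L)) where
  open Field L hiding (zero)
  open import Relation.Binary.Reasoning.Setoid setoid
  open import Algebra.Properties.Ring (CommutativeRing.ring (Field.ring L)) using (-‿distribˡ-*)
  open FiniteSums +-commutativeMonoid public

  opaque
    unfolding ∑

    *-distribˡ-∑ : ∀ {n} x (f : Vector Carrier n) → x * ∑ f ≈ ∑ (λ i → x * f i)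
    *-distribˡ-∑ = Algebra.Properties.Semiring.Sum.*-distribˡ-sum semiring

    *-distribʳ-∑ : ∀ {n} x (f : Vector Carrier n) → ∑ f * x ≈ ∑ (λ i → f i * x)
    *-distribʳ-∑ = Algebra.Properties.Semiring.Sum.*-distribʳ-sum semiring

  infix 5 ⟨_,_⟩

  ⟨_,_⟩ : ∀ {r} → Vector Carrier r → Vector Carrier r → Carrier
  ⟨ x , y ⟩ = ∑ (λ j → x j * y j)

  comb : ∀ {d} {A : Set} → Vector Carrier d → (Fin d → A → Carrier) → A → Carrier
  comb c u j = ∑ (λ i → c i * u i j)

  -- The coefficients range over all of L, even when the vectors have entries in a subfield.
  Indep : ∀ {d s} → (Fin d → Vector Carrier s) → Set
  Indep u = ∀ c → (∀ j → comb c u j ≈ 0#) → ∀ i → c i ≈ 0#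

  δ : ∀ {n} → Fin n → Fin n → Carrier
  δ i j = if does (i Fin.≟ j) then 1# else 0#

  δ-refl : ∀ {n} (i : Fin n) → δ i i ≈ 1#
  δ-refl i with i Fin.≟ i
  ... | yes _   = refl
  ... | no  i≢i = contradiction ≡.refl i≢i

  δ-off : ∀ {n} {i j : Fin n} → i ≢ j → δ i j ≈ 0#
  δ-off {i = i} {j} i≢j with i Fin.≟ j
  ... | yes i≡j = contradiction i≡j i≢j
  ... | no  _   = refl

  ∑-δʳ : ∀ {n} (f : Vector Carrier n) k → ∑ (λ i → f i * δ i k) ≈ f k
  ∑-δʳ f k = begin
    ∑ (λ i → f i * δ i k) ≈⟨ ∑-single _ k (λ i i≢k → trans (*-congˡ (δ-off i≢k)) (zeroʳ _)) ⟩
    f k * δ k k           ≈⟨ *-congˡ (δ-refl k) ⟩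
    f k * 1#              ≈⟨ *-identityʳ _ ⟩
    f k                   ∎

  ∑-δˡ : ∀ {n} (f : Vector Carrier n) k → ∑ (λ i → δ k i * f i) ≈ f k
  ∑-δˡ f k = begin
    ∑ (λ i → δ k i * f i) ≈⟨ ∑-single _ k (λ i i≢k → trans (*-congʳ (δ-off (i≢k ∘ ≡.sym))) (zeroˡ _)) ⟩
    δ k k * f k           ≈⟨ *-congʳ (δ-refl k) ⟩
    1# * f k              ≈⟨ *-identityˡ _ ⟩
    f k                   ∎

  -- Associativity (aB)y = a(By) of matrix products, by exchanging the two sums. It moves a pairing
  -- through a linear combination throughout.
  ∑-assoc : ∀ {r s} (a : Vector Carrier r) (B : Fin r → Fin s → Carrier) (y : Vector Carrier s) →
            ∑ (λ j → ∑ (λ i → a i * B i j) * y j) ≈ ∑ (λ i → a i * ∑ (λ j → B i j * y j))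
  ∑-assoc a B y = begin
    ∑ (λ j → ∑ (λ i → a i * B i j) * y j)   ≈⟨ ∑-cong (λ j → *-distribʳ-∑ (y j) _) ⟩
    ∑ (λ j → ∑ (λ i → a i * B i j * y j))   ≈⟨ ∑-comm _ ⟩
    ∑ (λ i → ∑ (λ j → a i * B i j * y j))   ≈⟨ ∑-cong (λ i → ∑-cong λ j → *-assoc _ _ _) ⟩
    ∑ (λ i → ∑ (λ j → a i * (B i j * y j))) ≈⟨ ∑-cong (λ i → sym (*-distribˡ-∑ (a i) _)) ⟩
    ∑ (λ i → a i * ∑ (λ j → B i j * y j))   ∎

  *-zeroʳ-≈ : ∀ {x y} → y ≈ 0# → x * y ≈ 0#
  *-zeroʳ-≈ y≈0 = trans (*-congˡ y≈0) (zeroʳ _)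

  *-zeroˡ-≈ : ∀ {x y} → x ≈ 0# → x * y ≈ 0#
  *-zeroˡ-≈ x≈0 = trans (*-congʳ x≈0) (zeroˡ _)

  ⟨⟩-comm : ∀ {r} (x y : Vector Carrier r) → ⟨ x , y ⟩ ≈ ⟨ y , x ⟩
  ⟨⟩-comm x y = ∑-cong λ j → *-comm (x j) (y j)

  ⟨⟩-+* : ∀ {r} (g x z : Vector Carrier r) a → ⟨ g , (λ j → x j + a * z j) ⟩ ≈ ⟨ g , x ⟩ + a * ⟨ g , z ⟩
  ⟨⟩-+* g x z a = begin
    ∑ (λ j → g j * (x j + a * z j))                  ≈⟨ ∑-cong (λ j → distribˡ _ _ _) ⟩
    ∑ (λ j → g j * x j + g j * (a * z j))            ≈⟨ ∑-distrib-+ _ _ ⟩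
    ⟨ g , x ⟩ + ∑ (λ j → g j * (a * z j))            ≈⟨ +-congˡ (∑-cong λ j → trans (sym (*-assoc _ _ _)) (trans (*-congʳ (*-comm _ _)) (*-assoc _ _ _))) ⟩
    ⟨ g , x ⟩ + ∑ (λ j → a * (g j * z j))            ≈⟨ +-congˡ (sym (*-distribˡ-∑ a _)) ⟩
    ⟨ g , x ⟩ + a * ⟨ g , z ⟩                         ∎

  ⟨⟩-+*ˡ : ∀ {r} (x z y : Vector Carrier r) a → ⟨ (λ j → x j + a * z j) , y ⟩ ≈ ⟨ x , y ⟩ + a * ⟨ z , y ⟩
  ⟨⟩-+*ˡ x z y a = trans (⟨⟩-comm _ y) (trans (⟨⟩-+* y x z a) (+-cong (⟨⟩-comm y x) (*-congˡ (⟨⟩-comm y z))))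

  ⟨⟩-zeroˡ : ∀ {r} {x : Vector Carrier r} y → (∀ j → x j ≈ 0#) → ⟨ x , y ⟩ ≈ 0#
  ⟨⟩-zeroˡ y x≈0 = ∑-zero λ j → *-zeroˡ-≈ (x≈0 j)

  ⟨⟩-zeroʳ : ∀ {r} x {y : Vector Carrier r} → (∀ j → y j ≈ 0#) → ⟨ x , y ⟩ ≈ 0#
  ⟨⟩-zeroʳ x y≈0 = ∑-zero λ j → *-zeroʳ-≈ (y≈0 j)

  ⟨⟩-+ˡ : ∀ {r} (x x′ y : Vector Carrier r) → ⟨ (λ j → x j + x′ j) , y ⟩ ≈ ⟨ x , y ⟩ + ⟨ x′ , y ⟩
  ⟨⟩-+ˡ x x′ y = trans (∑-cong λ j → distribʳ _ _ _) (∑-distrib-+ _ _)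

  ⟨⟩-*ˡ : ∀ {r} a (x y : Vector Carrier r) → ⟨ (λ j → a * x j) , y ⟩ ≈ a * ⟨ x , y ⟩
  ⟨⟩-*ˡ a x y = trans (∑-cong λ j → *-assoc _ _ _) (sym (*-distribˡ-∑ a _))

  -- Division by the pivot `a`, with `z` its inverse: this turns a linear dependence into membership
  -- in a span.
  isolate : ∀ {r a z y} {c b : Vector Carrier r} → a * z ≈ 1# → a * y + ⟨ c , b ⟩ ≈ 0# →
            y ≈ ⟨ (λ i → - z * c i) , b ⟩
  isolate {a = a} {z} {y} {c} {b} az≈1 rel = begin
    y                                     ≈⟨ *-identityˡ y ⟨
    1# * y                                ≈⟨ *-congʳ (trans (*-comm z a) az≈1) ⟨
    z * a * y                             ≈⟨ *-assoc z a y ⟩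
    z * (a * y)                           ≈⟨ +-identityʳ _ ⟨
    z * (a * y) + 0#                      ≈⟨ +-congˡ (-‿inverseʳ _) ⟨
    z * (a * y) + (z * s + - (z * s))     ≈⟨ +-assoc _ _ _ ⟨
    z * (a * y) + z * s + - (z * s)       ≈⟨ +-congʳ (distribˡ _ _ _) ⟨
    z * (a * y + s) + - (z * s)           ≈⟨ +-cong (*-zeroʳ-≈ rel) (-‿distribˡ-* z s) ⟩
    0# + - z * s                          ≈⟨ +-identityˡ _ ⟩
    - z * s                               ≈⟨ ⟨⟩-*ˡ (- z) c b ⟨
    ⟨ (λ i → - z * c i) , b ⟩             ∎
    where s = ⟨ c , b ⟩

  *-cancel-0 : ∀ {x y} → ¬ (x ≈ 0#) → x * y ≈ 0# → y ≈ 0#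
  *-cancel-0 {x} {y} x≉0 xy≈0 with inverse x x≉0
  ... | z , xz≈1 = begin
    y           ≈⟨ *-identityˡ y ⟨
    1# * y      ≈⟨ *-congʳ xz≈1 ⟨
    x * z * y   ≈⟨ *-congʳ (*-comm x z) ⟩
    z * x * y   ≈⟨ *-assoc z x y ⟩
    z * (x * y) ≈⟨ *-zeroʳ-≈ xy≈0 ⟩
    0#          ∎

  +-cancel-0 : ∀ {x y} → x ≈ 0# → x + y ≈ 0# → y ≈ 0#
  +-cancel-0 x≈0 x+y≈0 = trans (sym (trans (+-congʳ x≈0) (+-identityˡ _))) x+y≈0

  find-nonzero : ∀ {r} (x : Vector Carrier r) → (∃ λ j → ¬ (x j ≈ 0#)) ⊎ (∀ j → x j ≈ 0#)
  find-nonzero x with Finₚ.any? (λ j → ¬? (x j ≟ 0#))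
  ... | yes found = inj₁ found
  ... | no  none  = inj₂ zeros
    where
    zeros : ∀ j → x j ≈ 0#
    zeros j with x j ≟ 0#
    ... | yes xj≈0 = xj≈0
    ... | no  xj≉0 = contradiction (j , xj≉0) none

  Indep⇒nonzero : ∀ {d s} {u : Fin d → Vector Carrier s} → Indep u → ∀ i → ¬ (∀ j → u i j ≈ 0#)
  Indep⇒nonzero {u = u} ind i ui≈0 = 0≉1 (trans (sym (ind (δ i) (λ j → trans (∑-δˡ (λ k → u k j) i) (ui≈0 j)) i)) (δ-refl i))

  -- An elimination step. A relation `c` among the sheared vectors is a relation among the `u`, with
  -- the coefficient of the pivot row `p` equal to the sum of the `c i * a i`.
  Indep-shear : ∀ {d s} (u : Fin (suc d) → Vector Carrier s) p (a : Vector Carrier d) → Indep u →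
                Indep (λ i j → u (punchIn p i) j + a i * u p j)
  Indep-shear {d} u p a ind c c≈0 i = trans (sym (reflexive (Vectorₚ.insertAt-punchIn c p _ i))) (ind C C≈0 (punchIn p i))
    where
    C : Fin (suc d) → Carrier
    C = insertAt c p (∑ (λ i → c i * a i))
    C≈0 : ∀ j → comb C u j ≈ 0#
    C≈0 j = begin
      comb C u j
        ≈⟨ ∑-remove (λ i → C i * u i j) p ⟩
      C p * u p j + ∑ (λ i → C (punchIn p i) * u (punchIn p i) j)
        ≈⟨ +-cong (*-congʳ (reflexive (Vectorₚ.insertAt-lookup c p _))) (∑-cong λ i → *-congʳ (reflexive (Vectorₚ.insertAt-punchIn c p _ i))) ⟩
      ∑ (λ i → c i * a i) * u p j + ∑ (λ i → c i * u (punchIn p i) j)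
        ≈⟨ +-comm _ _ ⟩
      ∑ (λ i → c i * u (punchIn p i) j) + ∑ (λ i → c i * a i) * u p j
        ≈⟨ +-congˡ (trans (*-distribʳ-∑ _ _) (∑-cong λ i → *-assoc _ _ _)) ⟩
      ∑ (λ i → c i * u (punchIn p i) j) + ∑ (λ i → c i * (a i * u p j))
        ≈⟨ ∑-distrib-+ _ _ ⟨
      ∑ (λ i → c i * u (punchIn p i) j + c i * (a i * u p j))
        ≈⟨ ∑-cong (λ i → distribˡ _ _ _) ⟨
      ∑ (λ i → c i * (u (punchIn p i) j + a i * u p j))
        ≈⟨ c≈0 j ⟩
      0# ∎

  module OverSubfield (S : Carrier → Set) (sub : IsSubfield L S) where
    open IsSubfield sub

    ∑∈ : ∀ {n} {f : Vector Carrier n} → (∀ i → S (f i)) → S (∑ f)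
    ∑∈ {zero}  f∈ = resp _ _ (sym (∑-empty _)) 0∈
    ∑∈ {suc n} f∈ = resp _ _ (sym (∑-suc _)) (+∈ _ _ (f∈ zero) (∑∈ (f∈ ∘ suc)))

    ⟨⟩∈ : ∀ {n} {f g : Vector Carrier n} → (∀ i → S (f i)) → (∀ i → S (g i)) → S ⟨ f , g ⟩
    ⟨⟩∈ f∈ g∈ = ∑∈ λ i → *∈ _ _ (f∈ i) (g∈ i)

    δ∈ : ∀ {n} (i j : Fin n) → S (δ i j)
    δ∈ i j with i Fin.≟ j
    ... | yes _ = 1∈
    ... | no  _ = 0∈

    -- One linear equation costs at most one dimension. A vector with nonzero value under `f` serves
    -- as pivot and clears the others; division by that value stays in S. The new vectors are
    -- combinations of the old ones, so equations solved earlier stay solved, which is the last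
    -- component.
    cut : ∀ {d s} (u : Fin d → Vector Carrier s) → (∀ i j → S (u i j)) → Indep u →
          (f : Vector Carrier s) → (∀ j → S (f j)) →
          ∃ λ (u′ : Fin (pred d) → Vector Carrier s) →
            (∀ i j → S (u′ i j)) × Indep u′ × (∀ i → ⟨ f , u′ i ⟩ ≈ 0#)
            × (∀ g → (∀ i → ⟨ g , u i ⟩ ≈ 0#) → ∀ i → ⟨ g , u′ i ⟩ ≈ 0#)
    cut {zero} u u∈ ind f f∈ = u , u∈ , ind , (λ ()) , λ _ _ ()
    cut {suc d} {s} u u∈ ind f f∈ with find-nonzero (λ i → ⟨ f , u i ⟩)
    -- Nothing has to be cleared here; one vector is dropped all the same, to make the count exactly
    -- `pred d`.
    ... | inj₂ fu≈0 = u ∘ suc , u∈ ∘ suc , ind′ , fu≈0 ∘ suc , λ g gu≈0 → gu≈0 ∘ suc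
      where
      ind′ : Indep (u ∘ suc)
      ind′ c c≈0 i = ind (0# Vector.∷ c) (λ j → trans (∑-suc _) (trans (+-congʳ (zeroˡ _)) (trans (+-identityˡ _) (c≈0 j)))) (suc i)
    ... | inj₁ (p , fp≉0) with inverse _ fp≉0
    ... | z , fpz≈1 = u′ , u′∈ , Indep-shear u p a ind , fu′≈0 , λ g gu≈0 i → trans (⟨⟩-+* g _ _ _) (trans (+-cong (gu≈0 _) (*-zeroʳ-≈ (gu≈0 p))) (+-identityˡ _))
      where
      a : Fin d → Carrier
      a i = - (⟨ f , u (punchIn p i) ⟩ * z)
      u′ : Fin d → Vector Carrier s
      u′ i j = u (punchIn p i) j + a i * u p j
      u′∈ : ∀ i j → S (u′ i j)
      u′∈ i j = +∈ _ _ (u∈ _ j) (*∈ _ _ (-∈ _ (*∈ _ _ (⟨⟩∈ f∈ (u∈ _)) (inv∈ _ z (⟨⟩∈ f∈ (u∈ p)) fpz≈1))) (u∈ p j))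
      fu′≈0 : ∀ i → ⟨ f , u′ i ⟩ ≈ 0#
      fu′≈0 i = begin
        ⟨ f , u′ i ⟩                      ≈⟨ ⟨⟩-+* f _ _ _ ⟩
        v + - (v * z) * ⟨ f , u p ⟩       ≈⟨ +-congˡ (-‿distribˡ-* _ _) ⟨
        v + - (v * z * ⟨ f , u p ⟩)       ≈⟨ +-congˡ (-‿cong (trans (*-assoc _ _ _) (trans (*-congˡ (trans (*-comm _ _) fpz≈1)) (*-identityʳ v)))) ⟩
        v + - v                           ≈⟨ -‿inverseʳ v ⟩
        0#                                ∎
        where v = ⟨ f , u (punchIn p i) ⟩

    -- The unit vectors are cut by one row of `A` after the other. The result has entries in S and
    -- yet is independent over all of L; this lets relations over F be combined with codewords over
    -- L.
    kernel : ∀ {r s} (A : Fin r → Vector Carrier s) → (∀ k j → S (A k j)) →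
             ∃ λ (u : Fin (s ∸ r) → Vector Carrier s) →
               (∀ i j → S (u i j)) × Indep u × (∀ k i → ⟨ A k , u i ⟩ ≈ 0#)
    kernel {zero} A A∈ = δ , δ∈ , (λ c c≈0 i → trans (sym (∑-δʳ c i)) (c≈0 i)) , λ ()
    kernel {suc r} {s} A A∈ with kernel (A ∘ suc) (A∈ ∘ suc)
    ... | u , u∈ , ind , ker with cut u u∈ ind (A zero) (A∈ zero)
    ... | u′ , u′∈ , ind′ , A₀ , keep =
      ≡.subst (λ d → ∃ λ (u : Fin d → Vector Carrier s) → (∀ i j → S (u i j)) × Indep u × (∀ k i → ⟨ A k , u i ⟩ ≈ 0#))
              (ℕₚ.pred[m∸n]≡m∸[1+n] s r)
              (u′ , u′∈ , ind′ , λ { zero → A₀ ; (suc k) → keep (A (suc k)) (ker k) })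

    nontrivial : ∀ {r s} → r < s → (A : Fin r → Vector Carrier s) → (∀ k j → S (A k j)) →
                 ∃ λ (c : Vector Carrier s) →
                   (∀ j → S (c j)) × ¬ (∀ j → c j ≈ 0#) × (∀ k → ⟨ A k , c ⟩ ≈ 0#)
    nontrivial {r} {s} r<s A A∈ with s ∸ r | ℕₚ.m<n⇒0<n∸m r<s | kernel A A∈
    ... | suc d | _ | u , u∈ , ind , ker = u zero , u∈ zero , Indep⇒nonzero {u = u} ind zero , λ k → ker k zero

    -- The coordinates are the equations and the coefficients the unknowns. The two families are
    -- kept apart because the applications eliminate one of them by a pairing that annihilates the
    -- other.
    dependent : ∀ {a b s} → s < a ℕ.+ b → (V : Fin a → Vector Carrier s) (W : Fin b → Vector Carrier s) →
                (∀ i j → S (V i j)) → (∀ i j → S (W i j)) →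
                ∃ λ (α : Vector Carrier a) → ∃ λ (β : Vector Carrier b) →
                  (∀ i → S (α i)) × (∀ i → S (β i))
                  × (∀ j → comb α V j + comb β W j ≈ 0#)
                  × ¬ ((∀ i → α i ≈ 0#) × (∀ i → β i ≈ 0#))
    dependent {a} {b} s<a+b V W V∈ W∈ with nontrivial s<a+b (λ j i → (V ++ W) i j) (λ j i → V++W∈ i j)
      where
      V++W∈ : ∀ i j → S ((V ++ W) i j)
      V++W∈ i j with splitAt a i
      ... | inj₁ k = V∈ k j
      ... | inj₂ k = W∈ k j
    ... | c , c∈ , c≉0 , ker = α , β , (λ _ → c∈ _) , (λ _ → c∈ _) , rel , λ (α≈0 , β≈0) → c≉0 (all-zero α≈0 β≈0)
      where
      α : Vector Carrier a
      α i = c (i ↑ˡ b)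
      β : Vector Carrier b
      β i = c (a ↑ʳ i)
      rel : ∀ j → comb α V j + comb β W j ≈ 0#
      rel j = begin
        comb α V j + comb β W j
          ≈⟨ +-cong (∑-cong λ i → trans (*-congˡ (reflexive (≡.cong (λ v → v j) (≡.sym (Vectorₚ.lookup-++ˡ V W i))))) (*-comm _ _))
                    (∑-cong λ i → trans (*-congˡ (reflexive (≡.cong (λ v → v j) (≡.sym (Vectorₚ.lookup-++ʳ V W i))))) (*-comm _ _)) ⟩
        _ ≈⟨ ∑-split a _ ⟨
        ⟨ (λ i → (V ++ W) i j) , c ⟩ ≈⟨ ker j ⟩
        0# ∎
      all-zero : (∀ i → α i ≈ 0#) → (∀ i → β i ≈ 0#) → ∀ k → c k ≈ 0#
      all-zero α≈0 β≈0 k with splitAt a k in eq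
      ... | inj₁ i = ≡.subst (λ k → c k ≈ 0#) (Finₚ.splitAt⁻¹-↑ˡ eq) (α≈0 i)
      ... | inj₂ i = ≡.subst (λ k → c k ≈ 0#) (Finₚ.splitAt⁻¹-↑ʳ eq) (β≈0 i)

  module _ {c n} {f : Fin c → Fin n} (f-injective : ∀ {i j} → f i ≡ f j → i ≡ j) where
    -- `comb α (δ ∘ f)` is `α` transported along the injection `f` and extended by zero.
    extend-image : ∀ (α : Vector Carrier c) k → comb α (δ ∘ f) (f k) ≈ α k
    extend-image α k = begin
      ∑ (λ i → α i * δ (f i) (f k)) ≈⟨ ∑-single _ k (λ i i≢k → *-zeroʳ-≈ (δ-off (i≢k ∘ f-injective))) ⟩
      α k * δ (f k) (f k)           ≈⟨ *-congˡ (δ-refl (f k)) ⟩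
      α k * 1#                      ≈⟨ *-identityʳ _ ⟩
      α k                           ∎

    ⟨extend⟩ : ∀ (α : Vector Carrier c) (y : Vector Carrier n) → ⟨ comb α (δ ∘ f) , y ⟩ ≈ ⟨ α , y ∘ f ⟩
    ⟨extend⟩ α y = trans (∑-assoc α (δ ∘ f) y) (∑-cong λ i → *-congˡ (∑-δˡ y (f i)))

    Indep-∘ : ∀ {s} {u : Fin n → Vector Carrier s} → Indep u → Indep (u ∘ f)
    Indep-∘ {u = u} ind α α≈0 k = trans (sym (extend-image α k)) (ind (comb α (δ ∘ f)) (λ j → trans (⟨extend⟩ α (λ i → u i j)) (α≈0 j)) (f k))

  module _ {n c} {P : Fin n → Bool} (en : Enumeration P c) where
    open Enumeration en

    extend-off : ∀ (α : Vector Carrier c) j → P j ≡ false → comb α (δ ∘ ι) j ≈ 0#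
    extend-off α j Pj = ∑-zero λ i → *-zeroʳ-≈ (δ-off λ ιi≡j → contradiction (≡.trans (≡.sym (≡.trans (≡.cong P (≡.sym ιi≡j)) (ι-true i))) Pj) λ ())

    on-or-off : ∀ j → (∃ λ i → ι i ≡ j) ⊎ P j ≡ false
    on-or-off j with P j in Pj
    ... | true  = inj₁ (ι-onto j Pj)
    ... | false = inj₂ ≡.refl

    ⟨⟩-restrict : ∀ {x : Vector Carrier n} y → (∀ j → P j ≡ false → x j ≈ 0#) → ⟨ x , y ⟩ ≈ ⟨ x ∘ ι , y ∘ ι ⟩
    ⟨⟩-restrict {x} y x-off = trans (∑-cong λ j → *-congʳ (x≈ j)) (⟨extend⟩ ι-injective (x ∘ ι) y)
      where
      x≈ : ∀ j → x j ≈ comb (x ∘ ι) (δ ∘ ι) j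
      x≈ j with on-or-off j
      ... | inj₁ (i , ≡.refl) = sym (extend-image ι-injective (x ∘ ι) i)
      ... | inj₂ Pj = trans (x-off j Pj) (sym (extend-off (x ∘ ι) j Pj))

  -- Lets the elimination results for a subfield be used over L itself.
  wholeField : IsSubfield L (λ _ → ⊤)
  wholeField = record { resp = λ _ _ _ _ → tt ; 0∈ = tt ; 1∈ = tt ; +∈ = λ _ _ _ _ → tt ; -∈ = λ _ _ → tt ; *∈ = λ _ _ _ _ → tt ; inv∈ = λ _ _ _ _ → tt }

  module Whole = OverSubfield (λ _ → ⊤) wholeField

  Indep⇒≤ : ∀ {d s} {u : Fin d → Vector Carrier s} → Indep u → d ≤ s
  Indep⇒≤ {d} {s} {u} ind with d ℕ.≤? s
  ... | yes d≤s = d≤s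
  ... | no  d≰s with Whole.nontrivial (ℕₚ.≰⇒> d≰s) (λ j i → u i j) (λ _ _ → tt)
  ... | c , _ , c≉0 , ker = contradiction (ind c λ j → trans (∑-cong λ i → *-comm _ _) (ker j)) c≉0

  -- Gram-Schmidt for the pairing of two families. A rescaled unit vector `e′` pairs to 1 with the
  -- first row; the other rows are made orthogonal to `e′` and treated recursively; then the
  -- recursive solution is made orthogonal to the first row, and `e′` to the remaining rows.
  dualBasis : ∀ {K N} (g : Fin K → Vector Carrier N) → Indep g →
              ∃ λ (e : Fin K → Vector Carrier N) → ∀ k l → ⟨ g k , e l ⟩ ≈ δ k l
  dualBasis {zero} g ind = (λ ()) , λ ()
  dualBasis {suc K} {N} g ind with find-nonzero (g zero)
  ... | inj₂ g₀≈0 = contradiction g₀≈0 (Indep⇒nonzero {u = g} ind zero)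
  ... | inj₁ (p , gp≉0) with inverse _ gp≉0
  ... | z , gpz≈1 = e , duality
    where
    e′ : Vector Carrier N
    e′ j = δ j p * z
    a : Vector Carrier K
    a k = ⟨ g (suc k) , e′ ⟩
    g₀e′≈1 : ⟨ g zero , e′ ⟩ ≈ 1#
    g₀e′≈1 = begin
      ∑ (λ j → g zero j * (δ j p * z)) ≈⟨ ∑-cong (λ j → *-assoc _ _ _) ⟨
      ∑ (λ j → g zero j * δ j p * z)   ≈⟨ *-distribʳ-∑ z _ ⟨
      ∑ (λ j → g zero j * δ j p) * z   ≈⟨ *-congʳ (∑-δʳ (g zero) p) ⟩
      g zero p * z                     ≈⟨ gpz≈1 ⟩
      1#                               ∎
    g′ : Fin K → Vector Carrier N
    g′ k j = g (suc k) j + - a k * g zero j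
    rec : ∃ λ (e : Fin K → Vector Carrier N) → ∀ k l → ⟨ g′ k , e l ⟩ ≈ δ k l
    rec = dualBasis g′ (Indep-shear g zero (λ k → - a k) ind)
    e″ : Fin K → Vector Carrier N
    e″ = proj₁ rec
    b : Vector Carrier K
    b l = ⟨ g zero , e″ l ⟩
    minus-one : ∀ {x y} → y ≈ 1# → x + - x * y ≈ 0#
    minus-one {x} y≈1 = trans (+-congˡ (trans (*-congˡ y≈1) (*-identityʳ _))) (-‿inverseʳ x)
    es : Fin K → Vector Carrier N
    es l j = e″ l j + - b l * e′ j
    g₀es : ∀ l → ⟨ g zero , es l ⟩ ≈ 0#
    g₀es l = trans (⟨⟩-+* _ _ _ _) (minus-one g₀e′≈1)
    g′e′ : ∀ k → ⟨ g′ k , e′ ⟩ ≈ 0#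
    g′e′ k = trans (⟨⟩-+*ˡ _ _ _ _) (minus-one g₀e′≈1)
    g-es : ∀ k l → ⟨ g (suc k) , es l ⟩ ≈ δ k l
    g-es k l = begin
      ⟨ g (suc k) , es l ⟩                                 ≈⟨ +-identityʳ _ ⟨
      ⟨ g (suc k) , es l ⟩ + 0#                            ≈⟨ +-congˡ (*-zeroʳ-≈ (g₀es l)) ⟨
      ⟨ g (suc k) , es l ⟩ + - a k * ⟨ g zero , es l ⟩     ≈⟨ ⟨⟩-+*ˡ _ _ _ _ ⟨
      ⟨ g′ k , es l ⟩                                      ≈⟨ ⟨⟩-+* _ _ _ _ ⟩
      ⟨ g′ k , e″ l ⟩ + - b l * ⟨ g′ k , e′ ⟩              ≈⟨ +-cong (proj₂ rec k l) (*-zeroʳ-≈ (g′e′ k)) ⟩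
      δ k l + 0#                                           ≈⟨ +-identityʳ _ ⟩
      δ k l                                                ∎
    e : Fin (suc K) → Vector Carrier N
    e zero    j = e′ j + - 1# * comb a es j
    e (suc l) = es l
    g-comb : ∀ k → ⟨ g k , comb a es ⟩ ≈ ∑ (λ l → a l * ⟨ g k , es l ⟩)
    g-comb k = trans (⟨⟩-comm (g k) _) (trans (∑-assoc a es (g k)) (∑-cong λ l → *-congˡ (⟨⟩-comm _ _)))
    duality : ∀ k l → ⟨ g k , e l ⟩ ≈ δ k l
    duality zero zero = trans (⟨⟩-+* _ _ _ _) (trans (+-cong g₀e′≈1 (*-zeroʳ-≈ (trans (g-comb zero) (∑-zero λ l → *-zeroʳ-≈ (g₀es l))))) (+-identityʳ _))
    duality (suc k) zero = begin
      ⟨ g (suc k) , e zero ⟩                       ≈⟨ ⟨⟩-+* _ _ _ _ ⟩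
      a k + - 1# * ⟨ g (suc k) , comb a es ⟩       ≈⟨ +-congˡ (*-congˡ (trans (g-comb (suc k)) (trans (∑-cong λ l → trans (*-congˡ (g-es k l)) (*-comm _ _)) (∑-δˡ a k)))) ⟩
      a k + - 1# * a k                             ≈⟨ +-congˡ (trans (sym (-‿distribˡ-* _ _)) (-‿cong (*-identityˡ _))) ⟩
      a k + - a k                                  ≈⟨ -‿inverseʳ _ ⟩
      0#                                           ∎
    duality zero (suc l) = g₀es l
    duality (suc k) (suc l) = g-es k l

  -- `y`, the `h` and a basis dual to `g` are more than N vectors, hence dependent. Pairing the
  -- relation with `g k` leaves only the k-th dual coefficient, so these vanish; as `h` is
  -- independent, the coefficient of `y` does not, and the relation is solved for `y`.
  annihilator-spanned : ∀ {d K N} (h : Fin d → Vector Carrier N) (g : Fin K → Vector Carrier N) →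
    N ≤ d ℕ.+ K → Indep h → Indep g → (∀ i k → ⟨ h i , g k ⟩ ≈ 0#) →
    ∀ y → (∀ k → ⟨ y , g k ⟩ ≈ 0#) → ∃ λ c → ∀ j → y j ≈ comb c h j
  annihilator-spanned {d} {K} {N} h g N≤d+K h-ind g-ind h⊥g y y⊥g with dualBasis g g-ind
  ... | e , duality with Whole.dependent (s≤s N≤d+K) (y Vector.∷ h) e (λ _ _ → tt) (λ _ _ → tt)
  ... | α , β , _ , _ , rel , nontriv = solution
    where
    V⊥g : ∀ i k → ⟨ (y Vector.∷ h) i , g k ⟩ ≈ 0#
    V⊥g zero    = y⊥g
    V⊥g (suc i) = h⊥g i
    β≈0 : ∀ k → β k ≈ 0#
    β≈0 k = begin
      β k                                 ≈⟨ ∑-δˡ β k ⟨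
      ∑ (λ l → δ k l * β l)               ≈⟨ ∑-cong (λ l → trans (*-comm _ _) (*-congˡ (trans (sym (duality k l)) (⟨⟩-comm _ _)))) ⟩
      ∑ (λ l → β l * ⟨ e l , g k ⟩)       ≈⟨ ∑-assoc β e (g k) ⟨
      ⟨ comb β e , g k ⟩                  ≈⟨ +-cancel-0 (trans (∑-assoc α _ (g k)) (∑-zero λ i → *-zeroʳ-≈ (V⊥g i k))) (trans (sym (⟨⟩-+ˡ _ _ (g k))) (⟨⟩-zeroˡ (g k) rel)) ⟩
      0#                                  ∎
    rel′ : ∀ j → α zero * y j + comb (α ∘ suc) h j ≈ 0#
    rel′ j = begin
      α zero * y j + comb (α ∘ suc) h j   ≈⟨ ∑-suc (λ i → α i * (y Vector.∷ h) i j) ⟨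
      comb α (y Vector.∷ h) j             ≈⟨ +-cancel-0 (∑-zero λ l → *-zeroˡ-≈ (β≈0 l)) (trans (+-comm _ _) (rel j)) ⟩
      0#                                  ∎
    solution : ∃ λ c → ∀ j → y j ≈ comb c h j
    solution with α zero ≟ 0#
    ... | yes α₀≈0 = contradiction ((λ { zero → α₀≈0 ; (suc i) → h-ind (α ∘ suc) (λ j → +-cancel-0 (*-zeroˡ-≈ α₀≈0) (rel′ j)) i }) , β≈0) nontriv
    ... | no  α₀≉0 with inverse _ α₀≉0
    ... | z , az≈1 = (λ i → - z * α (suc i)) , λ j → isolate az≈1 (rel′ j)

-- Rank weights and duality of the weight bounds

module RankMetric (L : Field) (_≟_ : Decidable (Field._≈_ L)) (F : Field.Carrier L → Set) (sub : IsSubfield L F) (q : ℕ) (card : HasCard L F q) where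
  open Field L hiding (zero)
  open import Relation.Binary.Reasoning.Setoid setoid
  open LinearAlgebra L _≟_ public
  open OverSubfield F sub public
  open IsSubfield sub
  open FieldExtension L F using (module LinF; SpanF; HasRankWeight)
  open import Algebra.Properties.Ring (CommutativeRing.ring (Field.ring L)) using (-‿distribˡ-*)

  -- The rank weight in matrix form: with `b` the basis, b = E x and x = P b for matrices E, P over
  -- F. Keeping both makes E a left inverse of P.
  record RankData {r} (x : Vector Carrier r) (w : ℕ) : Set where
    field
      basis   : Vector Carrier w
      E       : Fin w → Vector Carrier r
      P       : Fin r → Vector Carrier w
      E∈      : ∀ k j → F (E k j)
      P∈      : ∀ j k → F (P j k)
      basis≈  : ∀ k → basis k ≈ ⟨ E k , x ⟩
      x≈      : ∀ j → x j ≈ ⟨ P j , basis ⟩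
      indep   : ∀ c → (∀ k → F (c k)) → ⟨ c , basis ⟩ ≈ 0# → ∀ k → c k ≈ 0#

  lincomb≈⟨⟩ : ∀ {d} (c v : Vector Carrier d) → LinF.lincomb c v ≈ ⟨ c , v ⟩
  lincomb≈⟨⟩ {zero}  c v = sym (∑-empty _)
  lincomb≈⟨⟩ {suc d} c v = trans (+-congˡ (lincomb≈⟨⟩ (c ∘ suc) (v ∘ suc))) (sym (∑-suc _))

  toRankData : ∀ {r} {x : Vector Carrier r} {w} → HasRankWeight x w → RankData x w
  toRankData {x = x} (b , b∈ , ind , spans) = record
    { basis  = b
    ; E      = proj₁ ∘ b∈
    ; P      = λ j → proj₁ (spans (x j) (x∈ j))
    ; E∈     = λ k → proj₁ (proj₂ (b∈ k))
    ; P∈     = λ j → proj₁ (proj₂ (spans (x j) (x∈ j)))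
    ; basis≈ = λ k → trans (proj₂ (proj₂ (b∈ k))) (lincomb≈⟨⟩ _ _)
    ; x≈     = λ j → trans (proj₂ (proj₂ (spans (x j) (x∈ j)))) (lincomb≈⟨⟩ _ _)
    ; indep  = λ c c∈ c≈0 → ind c c∈ (trans (lincomb≈⟨⟩ _ _) c≈0)
    }
    where
    x∈ : ∀ j → SpanF x (x j)
    x∈ j = δ j , δ∈ j , sym (trans (lincomb≈⟨⟩ _ _) (∑-δˡ x j))

  fromRankData : ∀ {r} {x : Vector Carrier r} {w} → RankData x w → HasRankWeight x w
  fromRankData {x = x} R = basis , (λ k → E k , E∈ k , trans (basis≈ k) (sym (lincomb≈⟨⟩ _ _)))
    , (λ c c∈ c≈0 → indep c c∈ (trans (sym (lincomb≈⟨⟩ _ _)) c≈0))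
    , λ a (c , c∈ , a≈) → comb c P , (λ k → ⟨⟩∈ c∈ (λ j → P∈ j k)) , (begin
        a                                ≈⟨ trans a≈ (lincomb≈⟨⟩ _ _) ⟩
        ⟨ c , x ⟩                        ≈⟨ ∑-cong (λ j → *-congˡ (x≈ j)) ⟩
        ∑ (λ j → c j * ⟨ P j , basis ⟩)  ≈⟨ ∑-assoc c P basis ⟨
        ⟨ comb c P , basis ⟩             ≈⟨ lincomb≈⟨⟩ _ _ ⟨
        LinF.lincomb (comb c P) basis    ∎)
    where open RankData R

  -- Every element of the finite field F is tried as the first coefficient.
  span? : ∀ {w} (b : Vector Carrier w) a → Dec (∃ λ c → (∀ k → F (c k)) × a ≈ ⟨ c , b ⟩)
  span? {zero} b a with a ≟ 0#
  ... | yes a≈0 = yes ((λ ()) , (λ ()) , trans a≈0 (sym (∑-empty _)))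
  ... | no  a≉0 = no λ (c , _ , a≈) → a≉0 (trans a≈ (∑-empty _))
  span? {suc w} b a with Finₚ.any? (λ i → span? (b ∘ suc) (a + - (proj₁ card i * b zero)))
  ... | yes (i , c , c∈ , a-≈) = yes (e i Vector.∷ c , (λ { zero → e∈ i ; (suc k) → c∈ k }) , (begin
      a                                          ≈⟨ +-identityʳ a ⟨
      a + 0#                                     ≈⟨ +-congˡ (-‿inverseˡ _) ⟨
      a + (- (e i * b zero) + e i * b zero)      ≈⟨ +-assoc _ _ _ ⟨
      a + - (e i * b zero) + e i * b zero        ≈⟨ +-congʳ a-≈ ⟩
      ⟨ c , b ∘ suc ⟩ + e i * b zero             ≈⟨ +-comm _ _ ⟩
      e i * b zero + ⟨ c , b ∘ suc ⟩             ≈⟨ ∑-suc (λ k → (e i Vector.∷ c) k * b k) ⟨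
      ⟨ e i Vector.∷ c , b ⟩                     ∎))
    where
    e = proj₁ card
    e∈ = proj₁ (proj₂ card)
  ... | no  none = no λ (c , c∈ , a≈) → let (i , c₀≈) = proj₂ (proj₂ (proj₂ card)) (c zero) (c∈ zero) in
      none (i , c ∘ suc , c∈ ∘ suc , (begin
        a + - (proj₁ card i * b zero)                             ≈⟨ +-cong (trans a≈ (∑-suc _)) (-‿cong (*-congʳ (sym c₀≈))) ⟩
        c zero * b zero + ⟨ c ∘ suc , b ∘ suc ⟩ + - (c zero * b zero) ≈⟨ +-congʳ (+-comm _ _) ⟩
        ⟨ c ∘ suc , b ∘ suc ⟩ + c zero * b zero + - (c zero * b zero) ≈⟨ +-assoc _ _ _ ⟩
        ⟨ c ∘ suc , b ∘ suc ⟩ + (c zero * b zero + - (c zero * b zero)) ≈⟨ +-congˡ (-‿inverseʳ _) ⟩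
        ⟨ c ∘ suc , b ∘ suc ⟩ + 0#                                ≈⟨ +-identityʳ _ ⟩
        ⟨ c ∘ suc , b ∘ suc ⟩                                     ∎))

  ⟨∷,∷⟩ : ∀ {r} a (c x : Vector Carrier (suc r)) → c zero ≈ a → ⟨ c , x ⟩ ≈ a * x zero + ⟨ c ∘ suc , x ∘ suc ⟩
  ⟨∷,∷⟩ a c x c₀≈a = trans (∑-suc _) (+-congʳ (*-congʳ c₀≈a))

  ⟨0∷,∷⟩ : ∀ {r} (c x : Vector Carrier (suc r)) → c zero ≈ 0# → ⟨ c , x ⟩ ≈ ⟨ c ∘ suc , x ∘ suc ⟩
  ⟨0∷,∷⟩ c x c₀≈0 = trans (⟨∷,∷⟩ 0# c x c₀≈0) (trans (+-congʳ (zeroˡ _)) (+-identityˡ _))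

  0∷∈ : ∀ {r} {c : Vector Carrier r} → (∀ k → F (c k)) → ∀ k → F ((0# Vector.∷ c) k)
  0∷∈ c∈ zero    = 0∈
  0∷∈ c∈ (suc k) = c∈ k

  -- The basis is chosen greedily from the coordinates: an entry joins it exactly when it is not in
  -- the F-span of the basis found for the later ones.
  rankData : ∀ {r} (x : Vector Carrier r) → ∃ (RankData x)
  rankData {zero} x = 0 , record
    { basis = λ () ; E = λ () ; P = λ () ; E∈ = λ () ; P∈ = λ () ; basis≈ = λ () ; x≈ = λ () ; indep = λ _ _ _ () }
  rankData {suc r} x with rankData (x ∘ suc)
  ... | w , R with span? (RankData.basis R) (x zero)
  ... | yes (c , c∈ , x₀≈) = w , record
    { basis  = basis
    ; E      = λ k → 0# Vector.∷ E k
    ; P      = c Vector.∷ P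
    ; E∈     = λ k → 0∷∈ (E∈ k)
    ; P∈     = λ { zero → c∈ ; (suc j) → P∈ j }
    ; basis≈ = λ k → trans (basis≈ k) (sym (⟨0∷,∷⟩ (0# Vector.∷ E k) x refl))
    ; x≈     = λ { zero → x₀≈ ; (suc j) → x≈ j }
    ; indep  = indep
    }
    where open RankData R
  ... | no x₀∉ = suc w , record
    { basis  = x zero Vector.∷ basis
    ; E      = δ zero Vector.∷ λ k → 0# Vector.∷ E k
    ; P      = δ zero Vector.∷ λ j → 0# Vector.∷ P j
    ; E∈     = λ { zero → δ∈ zero ; (suc k) → 0∷∈ (E∈ k) }
    ; P∈     = λ { zero → δ∈ zero ; (suc j) → 0∷∈ (P∈ j) }
    ; basis≈ = λ { zero → sym (∑-δˡ x zero) ; (suc k) → trans (basis≈ k) (sym (⟨0∷,∷⟩ (0# Vector.∷ E k) x refl)) }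
    ; x≈     = λ { zero → sym (∑-δˡ (x zero Vector.∷ basis) zero) ; (suc j) → trans (x≈ j) (sym (⟨0∷,∷⟩ (0# Vector.∷ P j) _ refl)) }
    ; indep  = indep′
    }
    where
    open RankData R
    indep′ : ∀ c → (∀ k → F (c k)) → ⟨ c , x zero Vector.∷ basis ⟩ ≈ 0# → ∀ k → c k ≈ 0#
    indep′ c c∈ c≈0 with c zero ≟ 0#
    ... | yes c₀≈0 = λ { zero → c₀≈0 ; (suc k) → indep (c ∘ suc) (c∈ ∘ suc) (trans (sym (⟨0∷,∷⟩ c _ c₀≈0)) c≈0) k }
    ... | no  c₀≉0 with inverse _ c₀≉0
    ... | z , c₀z≈1 = contradiction
      ((λ k → - z * c (suc k)) , (λ k → *∈ _ _ (-∈ _ (inv∈ _ _ (c∈ zero) c₀z≈1)) (c∈ (suc k))) , isolate c₀z≈1 (trans (sym (∑-suc _)) c≈0))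
      x₀∉

  -- The basis of x equals (ER)z. If w > d, the matrix ER over F has a nonzero left kernel vector
  -- over F, which would be a relation among the basis elements.
  rank≤ : ∀ {r w d} {x : Vector Carrier r} → RankData x w → (R : Fin r → Vector Carrier d) → (∀ j l → F (R j l)) →
          (z : Vector Carrier d) → (∀ j → x j ≈ ⟨ R j , z ⟩) → w ≤ d
  rank≤ {w = w} {d} {x} D R R∈ z x≈Rz with w ℕ.≤? d
  ... | yes w≤d = w≤d
  ... | no  w≰d with nontrivial (ℕₚ.≰⇒> w≰d) (λ l k → comb (RankData.E D k) R l) (λ l k → ⟨⟩∈ (RankData.E∈ D k) (λ j → R∈ j l))
  ... | c , c∈ , c≉0 , ker = contradiction (indep c c∈ (begin
    ⟨ c , basis ⟩                                 ≈⟨ ∑-cong (λ k → *-congˡ (trans (basis≈ k) (∑-cong λ j → *-congˡ (x≈Rz j)))) ⟩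
    ∑ (λ k → c k * ∑ (λ j → E k j * ⟨ R j , z ⟩)) ≈⟨ ∑-cong (λ k → *-congˡ (∑-assoc (E k) R z)) ⟨
    ∑ (λ k → c k * ⟨ comb (E k) R , z ⟩)          ≈⟨ ∑-assoc c (λ k → comb (E k) R) z ⟨
    ⟨ comb c (λ k → comb (E k) R) , z ⟩           ≈⟨ ⟨⟩-zeroˡ z (λ l → trans (∑-cong λ k → *-comm _ _) (ker l)) ⟩
    0#                                            ∎)) c≉0
    where open RankData D

  -- In L ⊗ L the hypothesis says Σⱼ xⱼ ⊗ yⱼ = 0.
  rank-orthogonal : ∀ {n d w w′} {x y : Vector Carrier n} → RankData x w → RankData y w′ →
    (Q : Fin n → Vector Carrier d) → (∀ j a → F (Q j a)) → (b : Vector Carrier d) → (∀ j → y j ≈ ⟨ Q j , b ⟩) →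
    (∀ a → comb x Q a ≈ 0#) → w ℕ.+ w′ ≤ n
  rank-orthogonal {n} {d} {w} {w′} {x} {y} X Y Q Q∈ b y≈Qb xQ≈0 with w ℕ.+ w′ ℕ.≤? n
  ... | yes w+w′≤n = w+w′≤n
  -- The w columns of `X.P` and the w′ rows of `Y.E` live in the n-dimensional space over F; they
  -- will turn out to be independent.
  ... | no  w+w′≰n with dependent (ℕₚ.≰⇒> w+w′≰n) (λ l j → RankData.P X j l) (RankData.E Y) (λ l j → RankData.P∈ X j l) (RankData.E∈ Y)
  ... | α , γ , α∈ , γ∈ , rel , nontriv = contradiction (α≈0 , γ≈0) nontriv
    where
    module X = RankData X
    module Y = RankData Y
    p : Fin w → Vector Carrier n
    p l j = X.P j l
    -- Descent from L to F: after expanding `x` the hypothesis is a relation with coefficients in F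
    -- among the basis elements of `x`, so each coefficient vanishes.
    p⊥Q : ∀ a l → comb (p l) Q a ≈ 0#
    p⊥Q a = X.indep (λ l → comb (p l) Q a) (λ l → ⟨⟩∈ (λ j → X.P∈ j l) (λ j → Q∈ j a)) (begin
      ∑ (λ l → ∑ (λ j → X.P j l * Q j a) * X.basis l)  ≈⟨ ∑-cong (λ l → *-congʳ (∑-cong λ j → *-comm _ _)) ⟩
      ∑ (λ l → ∑ (λ j → Q j a * X.P j l) * X.basis l)  ≈⟨ ∑-assoc (λ j → Q j a) X.P X.basis ⟩
      ∑ (λ j → Q j a * ⟨ X.P j , X.basis ⟩)            ≈⟨ ∑-cong (λ j → trans (*-comm _ _) (*-congʳ (sym (X.x≈ j)))) ⟩
      comb x Q a                                       ≈⟨ xQ≈0 a ⟩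
      0#                                               ∎)
    p⊥y : ∀ l → ⟨ p l , y ⟩ ≈ 0#
    p⊥y l = begin
      ⟨ p l , y ⟩                          ≈⟨ ∑-cong (λ j → *-congˡ (y≈Qb j)) ⟩
      ∑ (λ j → p l j * ⟨ Q j , b ⟩)        ≈⟨ ∑-assoc (p l) Q b ⟨
      ⟨ comb (p l) Q , b ⟩                 ≈⟨ ⟨⟩-zeroˡ b (λ a → p⊥Q a l) ⟩
      0#                                   ∎
    -- Pairing the relation with `y` removes the columns `p l` and leaves a relation over F in the
    -- basis of `y`.
    γ≈0 : ∀ l → γ l ≈ 0#
    γ≈0 = Y.indep γ γ∈ (begin
      ⟨ γ , Y.basis ⟩                      ≈⟨ ∑-cong (λ l → *-congˡ (Y.basis≈ l)) ⟩
      ∑ (λ l → γ l * ⟨ Y.E l , y ⟩)        ≈⟨ ∑-assoc γ Y.E y ⟨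
      ⟨ comb γ Y.E , y ⟩                   ≈⟨ +-cancel-0 (trans (∑-assoc α p y) (∑-zero λ l → *-zeroʳ-≈ (p⊥y l))) (trans (sym (⟨⟩-+ˡ _ _ y)) (⟨⟩-zeroˡ y rel)) ⟩
      0#                                   ∎)
    αp≈0 : ∀ j → comb α p j ≈ 0#
    αp≈0 j = +-cancel-0 (∑-zero λ l → *-zeroˡ-≈ (γ≈0 l)) (trans (+-comm _ _) (rel j))
    -- Both sides express `X.basis k` in the basis with coefficients in F. The left inverse then
    -- cancels the columns in the remaining relation.
    EP≈δ : ∀ k l → comb (X.E k) X.P l ≈ δ k l
    EP≈δ k l = begin
      comb (X.E k) X.P l                             ≈⟨ +-identityʳ _ ⟨
      comb (X.E k) X.P l + 0#                        ≈⟨ +-congˡ (-‿inverseˡ _) ⟨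
      comb (X.E k) X.P l + (- δ k l + δ k l)         ≈⟨ +-assoc _ _ _ ⟨
      comb (X.E k) X.P l + - δ k l + δ k l           ≈⟨ +-congʳ (X.indep (λ l → comb (X.E k) X.P l + - δ k l) (λ l → +∈ _ _ (⟨⟩∈ (X.E∈ k) (λ j → X.P∈ j l)) (-∈ _ (δ∈ k l))) difference l) ⟩
      0# + δ k l                                     ≈⟨ +-identityˡ _ ⟩
      δ k l                                          ∎
      where
      difference : ⟨ (λ l → comb (X.E k) X.P l + - δ k l) , X.basis ⟩ ≈ 0#
      difference = begin
        ⟨ (λ l → comb (X.E k) X.P l + - δ k l) , X.basis ⟩                ≈⟨ ⟨⟩-+ˡ _ _ X.basis ⟩
        ⟨ comb (X.E k) X.P , X.basis ⟩ + ⟨ (λ l → - δ k l) , X.basis ⟩    ≈⟨ +-cong (trans (∑-assoc (X.E k) X.P X.basis) (trans (∑-cong λ j → *-congˡ (sym (X.x≈ j))) (sym (X.basis≈ k)))) (∑-cong λ l → trans (*-congʳ (trans (-‿cong (sym (*-identityˡ _))) (-‿distribˡ-* 1# _))) (*-assoc _ _ _)) ⟩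
        X.basis k + ∑ (λ l → - 1# * (δ k l * X.basis l))                  ≈⟨ +-congˡ (trans (sym (*-distribˡ-∑ (- 1#) _)) (*-congˡ (∑-δˡ X.basis k))) ⟩
        X.basis k + - 1# * X.basis k                                      ≈⟨ +-congˡ (trans (sym (-‿distribˡ-* 1# _)) (-‿cong (*-identityˡ _))) ⟩
        X.basis k + - X.basis k                                           ≈⟨ -‿inverseʳ _ ⟩
        0#                                                                ∎
    α≈0 : ∀ l → α l ≈ 0#
    α≈0 k = begin
      α k                                          ≈⟨ ∑-δˡ α k ⟨
      ∑ (λ l → δ k l * α l)                        ≈⟨ ∑-cong (λ l → *-congʳ (sym (EP≈δ k l))) ⟩
      ∑ (λ l → ∑ (λ j → X.E k j * X.P j l) * α l)  ≈⟨ ∑-assoc (X.E k) X.P α ⟩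
      ∑ (λ j → X.E k j * ⟨ X.P j , α ⟩)            ≈⟨ ⟨⟩-zeroʳ (X.E k) (λ j → trans (⟨⟩-comm _ _) (αp≈0 j)) ⟩
      0#                                           ∎

  RankData-restrict : ∀ {n c w} {P : Fin n → Bool} (en : Enumeration P c) {x : Vector Carrier n} →
    (∀ j → P j ≡ false → x j ≈ 0#) → RankData x w → RankData (x ∘ Enumeration.ι en) w
  RankData-restrict en {x} x-off D = record
    { basis  = basis
    ; E      = λ k → E k ∘ ι
    ; P      = P ∘ ι
    ; E∈     = λ k → E∈ k ∘ ι
    ; P∈     = P∈ ∘ ι
    ; basis≈ = λ k → trans (basis≈ k) (trans (⟨⟩-comm (E k) x) (trans (⟨⟩-restrict en (E k) x-off) (⟨⟩-comm _ _)))
    ; x≈     = x≈ ∘ ι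
    ; indep  = indep
    }
    where
    open RankData D
    open Enumeration en using (ι)

  -- Duality of the weight bounds for an arbitrary partition into blocks

  module Blocks {N K t : ℕ} (blk : Fin N → Fin t) (kblk : Fin K → Fin t) where

    -- `J` is the exact set of nonzero blocks, each with an explicit nonzero coordinate.
    Supports : (Fin t → Bool) → Vector Carrier N → Set
    Supports J x = (∀ j → J (blk j) ≡ false → x j ≈ 0#)
                 × (∀ i → J i ≡ true → ∃ λ j → blk j ≡ i × ¬ (x j ≈ 0#))

    Nonempty : (Fin t → Bool) → Set
    Nonempty J = ∃ λ i → J i ≡ true

    support : ∀ x → ∃ λ J → Supports J x
    support x = (λ i → does (hit? i)) , off , on
      where
      hit? : ∀ i → Dec (∃ λ j → blk j ≡ i × ¬ (x j ≈ 0#))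
      hit? i = Finₚ.any? λ j → (blk j Fin.≟ i) ×-dec ¬? (x j ≟ 0#)
      off : ∀ j → does (hit? (blk j)) ≡ false → x j ≈ 0#
      off j eq with hit? (blk j)
      ... | no  none with x j ≟ 0#
      ... | yes xj≈0 = xj≈0
      ... | no  xj≉0 = contradiction (j , ≡.refl , xj≉0) none
      on : ∀ i → does (hit? i) ≡ true → ∃ λ j → blk j ≡ i × ¬ (x j ≈ 0#)
      on i eq with hit? i
      ... | yes hit = hit

    -- The code enters only through generators that each live in one block. `weights` is w ≥ N_J -
    -- K_J + 1 without truncated subtraction.
    module Duality (g : Fin K → Vector Carrier N) (g-ind : Indep g)
                   (g-block : ∀ l j → blk j ≢ kblk l → g l j ≈ 0#)
                   (weights : ∀ J α w → Supports J (comb α g) → Nonempty J → RankData (comb α g) w →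
                              suc (count (J ∘ blk)) ≤ w ℕ.+ count (J ∘ kblk)) where

      module Step (J : Fin t → Bool) (y : Vector Carrier N) (w : ℕ) (y⊥g : ∀ l → ⟨ g l , y ⟩ ≈ 0#)
                  (y-supp : Supports J y) (J≠∅ : Nonempty J) (Y : RankData y w)
                  (w≤ : w ≤ count (J ∘ kblk))
                  (smaller : ∀ J′ y′ w′ → count J′ < count J → (∀ l → ⟨ g l , y′ ⟩ ≈ 0#) → Supports J′ y′ →
                             Nonempty J′ → RankData y′ w′ → suc (count (J′ ∘ kblk)) ≤ w′) where

        open RankData Y renaming (P to Q; P∈ to Q∈; basis to b; x≈ to y≈Qb) using ()

        N_J K_J D : ℕ
        N_J = count (J ∘ blk)
        K_J = count (J ∘ kblk)
        D = N_J ∸ K_J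

        en : Enumeration (J ∘ blk) N_J
        en = enumerate (J ∘ blk)
        open Enumeration en

        kn : Enumeration (J ∘ kblk) K_J
        kn = enumerate (J ∘ kblk)
        open Enumeration kn renaming (ι to κ; ι-true to κ-true; ι-injective to κ-injective) using ()

        -- Since y = Q b, a vector over F that is orthogonal to all columns of `Q` on the blocks of
        -- `J` is an F-relation of `y`.
        A : Fin w → Vector Carrier N_J
        A a i = Q (ι i) a

        ker : ∃ λ (u : Fin (N_J ∸ w) → Vector Carrier N_J) →
                (∀ i j → F (u i j)) × Indep u × (∀ a i → ⟨ A a , u i ⟩ ≈ 0#)
        ker = kernel A (λ a i → Q∈ (ι i) a)

        D≤ : D ≤ N_J ∸ w
        D≤ = ℕₚ.∸-monoʳ-≤ N_J w≤

        inj : Fin D → Fin (N_J ∸ w)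
        inj i = Fin.inject≤ i D≤

        -- Only `D` of the relations are kept: enough to force a dependence with the K_J generators,
        -- and few enough that the resulting word has weight at most `D`.
        v : Fin D → Vector Carrier N_J
        v = proj₁ ker ∘ inj

        v∈ : ∀ i j → F (v i j)
        v∈ = proj₁ (proj₂ ker) ∘ inj

        v-ind : Indep v
        v-ind = Indep-∘ (Finₚ.inject≤-injective D≤ D≤ _ _) {u = proj₁ ker} (proj₁ (proj₂ (proj₂ ker)))

        v⊥A : ∀ i a → ⟨ v i , A a ⟩ ≈ 0#
        v⊥A i a = trans (⟨⟩-comm _ _) (proj₂ (proj₂ (proj₂ ker)) a (inj i))

        v⊥y : ∀ i → ⟨ v i , y ∘ ι ⟩ ≈ 0#
        v⊥y i = begin
          ⟨ v i , y ∘ ι ⟩                        ≈⟨ ∑-cong (λ j → *-congˡ (y≈Qb (ι j))) ⟩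
          ∑ (λ j → v i j * ⟨ Q (ι j) , b ⟩)      ≈⟨ ∑-assoc (v i) (Q ∘ ι) b ⟨
          ⟨ comb (v i) (Q ∘ ι) , b ⟩             ≈⟨ ⟨⟩-zeroˡ b (v⊥A i) ⟩
          0#                                     ∎

        κ-off : ∀ l j → J (blk j) ≡ false → g (κ l) j ≈ 0#
        κ-off l j Jj = g-block (κ l) j λ eq → contradiction (≡.trans (≡.sym (≡.trans (≡.cong J eq) (κ-true l))) Jj) λ ()

        G : Fin K_J → Vector Carrier N_J
        G l = g (κ l) ∘ ι

        G-ind : Indep G
        G-ind α α≈0 = Indep-∘ κ-injective {u = g} g-ind α everywhere
          where
          everywhere : ∀ j → comb α (g ∘ κ) j ≈ 0#
          everywhere j with on-or-off en j
          ... | inj₁ (i , ≡.refl) = α≈0 i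
          ... | inj₂ Jj = ∑-zero λ l → *-zeroʳ-≈ (κ-off l j Jj)

        G⊥y : ∀ l → ⟨ G l , y ∘ ι ⟩ ≈ 0#
        G⊥y l = trans (sym (⟨⟩-restrict en y (κ-off l))) (y⊥g (κ l))

        pivot : ∃ λ p → ¬ (y (ι p) ≈ 0#)
        pivot with proj₂ y-supp (proj₁ J≠∅) (proj₂ J≠∅)
        ... | j , ≡.refl , yj≉0 with ι-onto j (proj₂ J≠∅)
        ... | p , ≡.refl = p , yj≉0

        p : Fin N_J
        p = proj₁ pivot

        -- N_J + 1 vectors; all but the unit vector are orthogonal to y, so the latter does not
        -- take part in the relation.
        relation : ∃ λ (α : Vector Carrier K_J) → ∃ λ (β : Vector Carrier D) →
                     (∀ i → comb α G i + comb β v i ≈ 0#) × ¬ ((∀ l → α l ≈ 0#) × (∀ l → β l ≈ 0#))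
        relation with Whole.dependent (s≤s (ℕₚ.m≤n+m∸n N_J K_J)) (δ p Vector.∷ G) v (λ _ _ → tt) (λ _ _ → tt)
        ... | α , β , _ , _ , rel , nontriv =
          α ∘ suc , β , rel′ , λ (α≈0 , β≈0) → nontriv ((λ { zero → α₀≈0 ; (suc l) → α≈0 l }) , β≈0)
          where
          split : ∀ i → comb α (δ p Vector.∷ G) i ≈ α zero * δ p i + comb (α ∘ suc) G i
          split i = ∑-suc _
          α₀≈0 : α zero ≈ 0#
          α₀≈0 = *-cancel-0 (proj₂ pivot) (begin
            y (ι p) * α zero                                                            ≈⟨ *-comm _ _ ⟩
            α zero * y (ι p)                                                            ≈⟨ *-congˡ (∑-δˡ (y ∘ ι) p) ⟨
            α zero * ⟨ δ p , y ∘ ι ⟩                                                    ≈⟨ +-identityʳ _ ⟨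
            α zero * ⟨ δ p , y ∘ ι ⟩ + 0#                                               ≈⟨ +-congˡ (∑-zero λ l → *-zeroʳ-≈ (G⊥y l)) ⟨
            α zero * ⟨ δ p , y ∘ ι ⟩ + ∑ (λ l → α (suc l) * ⟨ G l , y ∘ ι ⟩)            ≈⟨ ∑-suc (λ l → α l * ⟨ (δ p Vector.∷ G) l , y ∘ ι ⟩) ⟨
            ∑ (λ l → α l * ⟨ (δ p Vector.∷ G) l , y ∘ ι ⟩)                              ≈⟨ ∑-assoc α (δ p Vector.∷ G) (y ∘ ι) ⟨
            ⟨ comb α (δ p Vector.∷ G) , y ∘ ι ⟩                                         ≈⟨ +-cancel-0 (trans (∑-assoc β v (y ∘ ι)) (∑-zero λ l → *-zeroʳ-≈ (v⊥y l))) (trans (+-comm _ _) (trans (sym (⟨⟩-+ˡ _ _ (y ∘ ι))) (⟨⟩-zeroˡ (y ∘ ι) rel))) ⟩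
            0#                                                                          ∎)
          rel′ : ∀ i → comb (α ∘ suc) G i + comb β v i ≈ 0#
          rel′ i = begin
            comb (α ∘ suc) G i + comb β v i                     ≈⟨ +-congʳ (trans (+-congʳ (*-zeroˡ-≈ α₀≈0)) (+-identityˡ _)) ⟨
            α zero * δ p i + comb (α ∘ suc) G i + comb β v i    ≈⟨ +-congʳ (split i) ⟨
            comb α (δ p Vector.∷ G) i + comb β v i              ≈⟨ rel i ⟩
            0#                                                  ∎

        α : Vector Carrier K_J
        α = proj₁ relation

        β : Vector Carrier D
        β = proj₁ (proj₂ relation)

        ᾱ : Vector Carrier K
        ᾱ = comb α (δ ∘ κ)

        c : Vector Carrier N
        c = comb ᾱ g

        c≈ : ∀ j → c j ≈ comb α (g ∘ κ) j
        c≈ j = ⟨extend⟩ κ-injective α (λ l → g l j)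

        c-off : ∀ j → J (blk j) ≡ false → c j ≈ 0#
        c-off j Jj = trans (c≈ j) (∑-zero λ l → *-zeroʳ-≈ (κ-off l j Jj))

        c+βv≈0 : ∀ i → c (ι i) + comb β v i ≈ 0#
        c+βv≈0 i = trans (+-congʳ (c≈ (ι i))) (proj₁ (proj₂ (proj₂ relation)) i)

        -- Each of the two families is independent by itself, so with c = 0 the whole relation would
        -- be trivial.
        c≉0 : ¬ (∀ j → c j ≈ 0#)
        c≉0 c≈0 = proj₂ (proj₂ (proj₂ relation))
          ( G-ind α (λ i → trans (sym (c≈ (ι i))) (c≈0 (ι i)))
          , v-ind β (λ i → +-cancel-0 (c≈0 (ι i)) (c+βv≈0 i)) )

        -- `c` is a combination over L of F-relations of `y`, each orthogonal to every column of
        -- `Q`. This is the strong orthogonality that `rank-orthogonal` requires.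
        c⊥Q : ∀ a → ⟨ c , (λ j → Q j a) ⟩ ≈ 0#
        c⊥Q a = trans (⟨⟩-restrict en _ c-off)
          (+-cancel-0 (trans (∑-assoc β v (A a)) (∑-zero λ l → *-zeroʳ-≈ (v⊥A l a)))
                      (trans (+-comm _ _) (trans (sym (⟨⟩-+ˡ _ _ (A a))) (⟨⟩-zeroˡ (A a) c+βv≈0))))

        J′ : Fin t → Bool
        J′ = proj₁ (support c)

        c-supp : Supports J′ c
        c-supp = proj₂ (support c)

        J′⊆J : ∀ i → J′ i ≡ true → J i ≡ true
        J′⊆J i J′i with J i in Ji
        ... | true  = ≡.refl
        ... | false with proj₂ c-supp i J′i
        ... | j , ≡.refl , cj≉0 = contradiction (c-off j Ji) cj≉0

        J′≠∅ : Nonempty J′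
        J′≠∅ with find-nonzero c
        ... | inj₂ c≈0 = contradiction c≈0 c≉0
        ... | inj₁ (j , cj≉0) with J′ (blk j) in J′j
        ... | true  = blk j , J′j
        ... | false = contradiction (proj₁ c-supp j J′j) cj≉0

        w-c : ℕ
        w-c = proj₁ (rankData c)

        X : RankData c w-c
        X = proj₂ (rankData c)

        bound : suc (count (J′ ∘ blk)) ≤ w-c ℕ.+ count (J′ ∘ kblk)
        bound = weights J′ ᾱ w-c c-supp J′≠∅ X

        -- As c = - Σ β_l v_l with the `v` over F, all entries of `c` lie in the F-span of the `D`
        -- scalars `β`.
        w-c≤D : w-c ≤ D
        w-c≤D = rank≤ X (λ j l → comb (λ i → - v l i) (δ ∘ ι) j) (λ j l → ⟨⟩∈ (λ i → -∈ _ (v∈ l i)) (λ i → δ∈ (ι i) j)) β expand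
          where
          expand : ∀ j → c j ≈ ⟨ (λ l → comb (λ i → - v l i) (δ ∘ ι) j) , β ⟩
          expand j with on-or-off en j
          ... | inj₂ Jj = trans (c-off j Jj) (sym (⟨⟩-zeroˡ β λ l → extend-off en (λ i → - v l i) j Jj))
          ... | inj₁ (i , ≡.refl) = begin
            c (ι i)                                                 ≈⟨ isolate (*-identityˡ 1#) (trans (+-congʳ (*-identityˡ _)) (c+βv≈0 i)) ⟩
            ∑ (λ l → - 1# * β l * v l i)                            ≈⟨ ∑-cong (λ l → trans (*-congʳ (trans (sym (-‿distribˡ-* _ _)) (-‿cong (*-identityˡ _)))) (trans (sym (-‿distribˡ-* _ _)) (trans (-‿cong (*-comm _ _)) (-‿distribˡ-* _ _)))) ⟩
            ∑ (λ l → - v l i * β l)                                 ≈⟨ ∑-cong (λ l → *-congʳ (extend-image ι-injective (λ i → - v l i) i)) ⟨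
            ⟨ (λ l → comb (λ i → - v l i) (δ ∘ ι) (ι i)) , β ⟩      ∎

        y′ : Vector Carrier N
        y′ j = if J′ (blk j) then y j else 0#

        y′-on : ∀ j → J′ (blk j) ≡ true → y′ j ≈ y j
        y′-on j J′j rewrite J′j = refl

        y′-off : ∀ j → J′ (blk j) ≡ false → y′ j ≈ 0#
        y′-off j J′j rewrite J′j = refl

        -- A generator lives in one block, where `y′` is either `y` or zero.
        y′⊥g : ∀ l → ⟨ g l , y′ ⟩ ≈ 0#
        y′⊥g l with J′ (kblk l) in J′l
        ... | false = ∑-zero term
          where
          term : ∀ j → g l j * y′ j ≈ 0#
          term j with blk j Fin.≟ kblk l
          ... | yes eq = *-zeroʳ-≈ (y′-off j (≡.trans (≡.cong J′ eq) J′l))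
          ... | no  ne = *-zeroˡ-≈ (g-block l j ne)
        ... | true = trans (∑-cong term) (y⊥g l)
          where
          term : ∀ j → g l j * y′ j ≈ g l j * y j
          term j with blk j Fin.≟ kblk l
          ... | yes eq = *-congˡ (y′-on j (≡.trans (≡.cong J′ eq) J′l))
          ... | no  ne = trans (*-zeroˡ-≈ (g-block l j ne)) (sym (*-zeroˡ-≈ (g-block l j ne)))

        y′-supp : Supports J′ y′
        y′-supp = y′-off , on
          where
          on : ∀ i → J′ i ≡ true → ∃ λ j → blk j ≡ i × ¬ (y′ j ≈ 0#)
          on i J′i with proj₂ y-supp i (J′⊆J i J′i)
          ... | j , ≡.refl , yj≉0 = j , ≡.refl , λ y′j≈0 → yj≉0 (trans (sym (y′-on j J′i)) y′j≈0)

        absurd : ⊥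
        absurd with Finₚ.any? (λ i → ¬? (J i Bool.≟ J′ i))
        ... | no same = ℕₚ.<-irrefl ≡.refl
              (ℕₚ.≤-trans (≡.subst₂ (λ n k → suc n ≤ w-c ℕ.+ k) (count-cong (λ j → J′≗J (blk j))) (count-cong (λ l → J′≗J (kblk l))) bound)
              -- Independence of `G` gives K_J ≤ N_J, so the subtraction in `D` is not truncated.
              (ℕₚ.≤-trans (ℕₚ.+-monoˡ-≤ K_J w-c≤D) (ℕₚ.≤-reflexive (ℕₚ.m∸n+n≡m (Indep⇒≤ {u = G} G-ind)))))
          where
          J′≗J : ∀ i → J′ i ≡ J i
          J′≗J i with J i Bool.≟ J′ i
          ... | yes eq = ≡.sym eq
          ... | no  ne = contradiction (i , ne) same
        ... | yes (i , Ji≢J′i) = ℕₚ.<-irrefl ≡.refl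
              (ℕₚ.≤-trans bound (ℕₚ.≤-trans (ℕₚ.+-monoʳ-≤ w-c (ℕₚ.≤-trans (ℕₚ.n≤1+n _) K_J′<w′)) w-c+w′≤))
          where
          differ : ∀ i → J i ≢ J′ i → J′ i ≡ false × J i ≡ true
          differ i ne with J i | J′ i | J′⊆J i
          ... | true  | false | _  = ≡.refl , ≡.refl
          ... | true  | true  | _  = contradiction ≡.refl ne
          ... | false | false | _  = contradiction ≡.refl ne
          ... | false | true  | ⊆J = contradiction (⊆J ≡.refl) λ ()
          w′ = proj₁ (rankData y′)
          en′ = enumerate (J′ ∘ blk)
          open Enumeration en′ using () renaming (ι to ι′; ι-true to ι′-true)
          K_J′<w′ : suc (count (J′ ∘ kblk)) ≤ w′
          K_J′<w′ = smaller J′ y′ w′ (count-mono-< J′⊆J i (proj₁ (differ i Ji≢J′i)) (proj₂ (differ i Ji≢J′i))) y′⊥g y′-supp J′≠∅ (proj₂ (rankData y′))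
          -- On the blocks of `J′` the vector `y′` still factors through the rows of `Q`, and `c`
          -- vanishes elsewhere, so `c⊥Q` survives the restriction.
          w-c+w′≤ : w-c ℕ.+ w′ ≤ count (J′ ∘ blk)
          w-c+w′≤ = rank-orthogonal (RankData-restrict en′ (proj₁ c-supp) X) (RankData-restrict en′ y′-off (proj₂ (rankData y′)))
            (Q ∘ ι′) (Q∈ ∘ ι′) b (λ k → trans (y′-on (ι′ k) (ι′-true k)) (y≈Qb (ι′ k)))
            (λ a → trans (sym (⟨⟩-restrict en′ (λ j → Q j a) (proj₁ c-supp))) (c⊥Q a))

      -- Strong induction on the number of nonzero blocks, with `s` as its bound.
      dual-weights′ : ∀ s J y w → count J < s → (∀ l → ⟨ g l , y ⟩ ≈ 0#) → Supports J y → Nonempty J → RankData y w →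
                      suc (count (J ∘ kblk)) ≤ w
      dual-weights′ (suc s) J y w (s≤s |J|≤s) y⊥g y-supp J≠∅ Y with suc (count (J ∘ kblk)) ℕ.≤? w
      ... | yes le = le
      ... | no  ≰w = ⊥-elim (Step.absurd J y w y⊥g y-supp J≠∅ Y (ℕₚ.≮⇒≥ ≰w)
              λ J″ y″ w″ lt → dual-weights′ s J″ y″ w″ (ℕₚ.≤-trans lt |J|≤s))

      dual-weights : ∀ J y w → (∀ l → ⟨ g l , y ⟩ ≈ 0#) → Supports J y → Nonempty J → RankData y w →
                     suc (count (J ∘ kblk)) ≤ w
      dual-weights J y w = dual-weights′ (suc (count J)) J y w ℕₚ.≤-refl

-- Consecutive blocks of coordinates

open import Algebra.Properties.CommutativeSemigroup ℕₚ.+-commutativeSemigroup using () renaming (interchange to +-interchange)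

module ℕSums = FiniteSums ℕₚ.+-0-commutativeMonoid

indicator : Bool → ℕ → ℕ
indicator p a = if p then a else 0

count≡∑ : ∀ {n} (P : Fin n → Bool) → count P ≡ ℕSums.∑ (λ i → indicator (P i) 1)
count≡∑ {zero}  P = ≡.sym (ℕSums.∑-empty _)
count≡∑ {suc n} P = ≡.trans head-term (≡.sym (ℕSums.∑-suc (λ i → indicator (P i) 1)))
  where
  head-term : count P ≡ indicator (P zero) 1 ℕ.+ ℕSums.∑ (λ i → indicator (P (suc i)) 1)
  head-term with P zero
  ... | true  = ≡.cong suc (count≡∑ (P ∘ suc))
  ... | false = count≡∑ (P ∘ suc)

-- Glues functions on the blocks to one on all coordinates; `blk` and block-diagonal generators
-- arise this way.
collect : ∀ {A : Set} {t} (n : Vec ℕ t) → (∀ i → Fin (lookup n i) → A) → Fin (sum n) → A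
collect []      f ()
collect (a ∷ n) f j = [ f zero , collect n (λ i → f (suc i)) ]′ (splitAt a j)

collect-embed : ∀ {A : Set} {t} (n : Vec ℕ t) (f : ∀ i → Fin (lookup n i) → A) i j → collect n f (embed n i j) ≡ f i j
collect-embed (a ∷ n) f zero    j rewrite Finₚ.splitAt-↑ˡ a j (sum n) = ≡.refl
collect-embed (a ∷ n) f (suc i) j rewrite Finₚ.splitAt-↑ʳ a (sum n) (embed n i j) = collect-embed n (λ i → f (suc i)) i j

embed-onto : ∀ {t} (n : Vec ℕ t) j → ∃ λ i → ∃ λ j′ → embed n i j′ ≡ j
embed-onto (a ∷ n) j with splitAt a j in eq
... | inj₁ j₁ = zero , j₁ , Finₚ.splitAt⁻¹-↑ˡ eq
... | inj₂ j₂ with embed-onto n j₂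
... | i , j′ , ≡.refl = suc i , j′ , Finₚ.splitAt⁻¹-↑ʳ eq

blk : ∀ {t} (n : Vec ℕ t) → Fin (sum n) → Fin t
blk n = collect n (λ i _ → i)

blk-embed : ∀ {t} (n : Vec ℕ t) i j → blk n (embed n i j) ≡ i
blk-embed n = collect-embed n (λ i _ → i)

count-blk : ∀ {t} (n : Vec ℕ t) (J : Fin t → Bool) → count (J ∘ blk n) ≡ ℕSums.∑ (λ i → indicator (J i) (lookup n i))
count-blk n J = begin
  count (J ∘ blk n)                                                             ≡⟨ count≡∑ (J ∘ blk n) ⟩
  ℕSums.∑ (λ j → indicator (J (blk n j)) 1)                                     ≡⟨ ℕSums.∑-embed n _ ⟩
  ℕSums.∑ (λ i → ℕSums.∑ (λ j → indicator (J (blk n (embed n i j))) 1))         ≡⟨ ℕSums.∑-cong (λ i → inner i) ⟩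
  ℕSums.∑ (λ i → indicator (J i) (lookup n i))                                  ∎
  where
  open ≡.≡-Reasoning
  constant : ∀ m b → ℕSums.∑ {m} (λ _ → indicator b 1) ≡ indicator b m
  constant m b = ≡.trans (≡.sym (count≡∑ {m} (λ _ → b))) (count-constant m b)
    where
    count-constant : ∀ m b → count {m} (λ _ → b) ≡ indicator b m
    count-constant m       true  = count-true (λ _ → ≡.refl)
    count-constant zero    false = ≡.refl
    count-constant (suc m) false = count-constant m false
  inner : ∀ i → ℕSums.∑ (λ j → indicator (J (blk n (embed n i j))) 1) ≡ indicator (J i) (lookup n i)
  inner i = ≡.trans (ℕSums.∑-cong λ j → ≡.cong (λ i → indicator (J i) 1) (blk-embed n i j)) (constant (lookup n i) (J i))

adjoin : ∀ {t} → (Fin t → Bool) → Fin t → Fin t → Bool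
adjoin J i i′ = J i′ ∨ does (i′ Fin.≟ i)

count-adjoin : ∀ {t} (n : Vec ℕ t) (J : Fin t → Bool) i → J i ≡ false →
               count (adjoin J i ∘ blk n) ≡ count (J ∘ blk n) ℕ.+ lookup n i
count-adjoin n J i Ji = begin
  count (adjoin J i ∘ blk n)                                                           ≡⟨ count-blk n (adjoin J i) ⟩
  ℕSums.∑ (λ i′ → indicator (adjoin J i i′) (lookup n i′))                             ≡⟨ ℕSums.∑-cong pointwise ⟩
  ℕSums.∑ (λ i′ → indicator (J i′) (lookup n i′) ℕ.+ single i′)                        ≡⟨ ℕSums.∑-distrib-+ _ _ ⟩
  ℕSums.∑ (λ i′ → indicator (J i′) (lookup n i′)) ℕ.+ ℕSums.∑ single                   ≡⟨ ≡.cong₂ ℕ._+_ (≡.sym (count-blk n J)) (≡.trans (ℕSums.∑-single single i off) on) ⟩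
  count (J ∘ blk n) ℕ.+ lookup n i                                                     ∎
  where
  open ≡.≡-Reasoning
  single : _ → ℕ
  single i′ = indicator (does (i′ Fin.≟ i)) (lookup n i′)
  pointwise : ∀ i′ → indicator (adjoin J i i′) (lookup n i′) ≡ indicator (J i′) (lookup n i′) ℕ.+ single i′
  pointwise i′ with i′ Fin.≟ i
  ... | yes ≡.refl rewrite Ji = ≡.refl
  ... | no  _ with J i′
  ... | true  = ≡.sym (ℕₚ.+-identityʳ _)
  ... | false = ≡.refl
  off : ∀ i′ → i′ ≢ i → single i′ ≡ 0
  off i′ i′≢i with i′ Fin.≟ i
  ... | yes eq = contradiction eq i′≢i
  ... | no  _  = ≡.refl
  on : single i ≡ lookup n i
  on with i Fin.≟ i
  ... | yes _   = ≡.refl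
  ... | no  i≢i = contradiction ≡.refl i≢i

-- Arithmetic of lengths and dimensions

sum-zipWith-∸ : ∀ {t} (n k : Vec ℕ t) → (∀ i → lookup k i ≤ lookup n i) → sum (zipWith _∸_ n k) ℕ.+ sum k ≡ sum n
sum-zipWith-∸ []      []      k≤n = ≡.refl
sum-zipWith-∸ (a ∷ n) (b ∷ k) k≤n = ≡.trans (+-interchange (a ∸ b) _ b (sum k))
  (≡.cong₂ ℕ._+_ (ℕₚ.m∸n+n≡m (k≤n zero)) (sum-zipWith-∸ n k (k≤n ∘ suc)))

zipWith-∸-involutive : ∀ {t} (n k : Vec ℕ t) → (∀ i → lookup k i ≤ lookup n i) → zipWith _∸_ n (zipWith _∸_ n k) ≡ k
zipWith-∸-involutive []      []      k≤n = ≡.refl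
zipWith-∸-involutive (a ∷ n) (b ∷ k) k≤n = ≡.cong₂ _∷_ (ℕₚ.m∸[m∸n]≡n (k≤n zero)) (zipWith-∸-involutive n k (k≤n ∘ suc))

suc-∸-≤ : ∀ {n k w} → suc (n ∸ k) ≤ w → suc n ≤ w ℕ.+ k
suc-∸-≤ {n} {k} {w} le = ℕₚ.≤-trans (s≤s (ℕₚ.≤-trans (ℕₚ.m≤n+m∸n n k) (ℕₚ.≤-reflexive (ℕₚ.+-comm k _)))) (ℕₚ.+-monoˡ-≤ k le)

-- Filling a block adds n to the length, k to the dimension and at most n - k to the weight, so the
-- bound passes back from the larger support to the smaller one.
fill-arithmetic : ∀ {w w⁺ N K n k} → k ≤ n → w⁺ ≤ w ℕ.+ (n ∸ k) → suc (N ℕ.+ n) ≤ w⁺ ℕ.+ (K ℕ.+ k) → suc N ≤ w ℕ.+ K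
fill-arithmetic {w} {w⁺} {N} {K} {n} {k} k≤n w⁺≤ le = ℕₚ.+-cancelʳ-≤ n (suc N) (w ℕ.+ K) (begin
  suc (N ℕ.+ n)                    ≤⟨ le ⟩
  w⁺ ℕ.+ (K ℕ.+ k)                 ≤⟨ ℕₚ.+-monoˡ-≤ (K ℕ.+ k) w⁺≤ ⟩
  w ℕ.+ (n ∸ k) ℕ.+ (K ℕ.+ k)      ≡⟨ +-interchange w (n ∸ k) K k ⟩
  w ℕ.+ K ℕ.+ (n ∸ k ℕ.+ k)        ≡⟨ ≡.cong (w ℕ.+ K ℕ.+_) (ℕₚ.m∸n+n≡m k≤n) ⟩
  w ℕ.+ K ℕ.+ n                    ∎)
  where open ℕₚ.≤-Reasoning

-- a - b is expanded in the basis of L over F; its coordinates are compared with zero through their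
-- indices in the enumeration of F.
decidable-≈ : ∀ {L F q m} → IsExtension L F q m → Decidable (Field._≈_ L)
decidable-≈ {L} {F} {q} {m} ext a b = result
  where
  open Field L hiding (zero)
  open IsExtension ext
  open IsSubfield subfield using (0∈)
  open FieldExtension L F using (module LinF)
  open import Algebra.Properties.Group +-group using (x∙y⁻¹≈ε⇒x≈y)
  e = proj₁ card
  index = proj₂ (proj₂ (proj₂ card))
  v = proj₁ degree
  expansion = proj₂ (proj₂ (proj₂ degree)) (a + - b) tt
  c = proj₁ expansion
  c∈ = proj₁ (proj₂ expansion)
  lincomb-zero : ∀ {d} (c v : Fin d → Carrier) → (∀ k → c k ≈ 0#) → LinF.lincomb c v ≈ 0#
  lincomb-zero {zero}  c v c≈0 = refl
  lincomb-zero {suc d} c v c≈0 = trans (+-cong (trans (*-congʳ (c≈0 zero)) (zeroˡ _)) (lincomb-zero (c ∘ suc) (v ∘ suc) (c≈0 ∘ suc))) (+-identityˡ _)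
  c≈0? : ∀ k → Dec (c k ≈ 0#)
  c≈0? k with index (c k) (c∈ k) | index 0# 0∈
  ... | i , ck≈ei | j , 0≈ej with i Fin.≟ j
  ... | yes ≡.refl = yes (trans ck≈ei (sym 0≈ej))
  ... | no  i≢j    = no λ ck≈0 → i≢j (proj₁ (proj₂ (proj₂ card)) i j (trans (sym ck≈ei) (trans ck≈0 0≈ej)))
  result : Dec (a ≈ b)
  result with Finₚ.all? c≈0?
  ... | yes c≈0 = yes (x∙y⁻¹≈ε⇒x≈y a b (trans (proj₂ (proj₂ expansion)) (lincomb-zero c v c≈0)))
  ... | no  c≉0 = no λ a≈b → c≉0 (proj₁ (proj₂ (proj₂ degree)) c c∈ (trans (sym (proj₂ (proj₂ expansion))) (trans (+-congʳ a≈b) (-‿inverseʳ b))))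

-- Codes, MRD codes and block MRD codes

module Codes (L : Field) (_≟_ : Decidable (Field._≈_ L)) (F : Field.Carrier L → Set) (sub : IsSubfield L F) (q : ℕ) (card : HasCard L F q) where
  open Field L hiding (zero)
  open import Relation.Binary.Reasoning.Setoid setoid
  open RankMetric L _≟_ F sub q card
  open IsSubfield sub using (0∈; +∈; *∈)
  open FieldExtension L F

  dot≈⟨⟩ : ∀ {r} (x y : Vect r) → dot x y ≈ ⟨ x , y ⟩
  dot≈⟨⟩ {zero}  x y = sym (∑-empty _)
  dot≈⟨⟩ {suc r} x y = trans (+-congˡ (dot≈⟨⟩ (x ∘ suc) (y ∘ suc))) (sym (∑-suc _))

  lincomb≈comb : ∀ {r d} (c : Fin d → Carrier) (v : Fin d → Vect r) j → LinL.lincomb r c v j ≈ comb c v j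
  lincomb≈comb {d = zero}  c v j = sym (∑-empty _)
  lincomb≈comb {d = suc d} c v j = trans (+-congˡ (lincomb≈comb (c ∘ suc) (v ∘ suc) j)) (sym (∑-suc _))

  LinIndep⇒Indep : ∀ {r d} {v : Fin d → Vect r} → LinL.LinIndep r v → Indep v
  LinIndep⇒Indep {v = v} ind c c≈0 = ind c (λ _ → tt) (λ j → trans (lincomb≈comb c v j) (c≈0 j))

  module LinearCode {r k} {C : Code r} (code : IsCode C k) where
    open IsCode code public

    g : Fin k → Vect r
    g = proj₁ dim

    g∈ : ∀ l → C (g l)
    g∈ = proj₁ (proj₂ dim)

    g-indep : Indep g
    g-indep = LinIndep⇒Indep {v = g} (proj₁ (proj₂ (proj₂ dim)))

    coefficients : ∀ x → C x → ∃ λ c → ∀ j → x j ≈ comb c g j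
    coefficients x x∈ with proj₂ (proj₂ (proj₂ dim)) x x∈
    ... | c , _ , x≈ = c , λ j → trans (x≈ j) (lincomb≈comb c g j)

    lincomb∈ : ∀ {d} (c : Fin d → Carrier) (v : Fin d → Vect r) → (∀ l → C (v l)) → C (LinL.lincomb r c v)
    lincomb∈ {zero}  c v v∈ = zero∈
    lincomb∈ {suc d} c v v∈ = IsCode.+∈ code _ _ (·∈ _ _ (v∈ zero)) (lincomb∈ (c ∘ suc) (v ∘ suc) (v∈ ∘ suc))

    comb∈ : ∀ {d} (c : Fin d → Carrier) (v : Fin d → Vect r) → (∀ l → C (v l)) → C (comb c v)
    comb∈ c v v∈ = resp _ _ (lincomb≈comb c v) (lincomb∈ c v v∈)

    ⊥g⇒dual : ∀ y → (∀ l → ⟨ g l , y ⟩ ≈ 0#) → dual C y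
    ⊥g⇒dual y y⊥g x x∈ with coefficients x x∈
    ... | c , x≈ = begin
      dot x y                           ≈⟨ dot≈⟨⟩ x y ⟩
      ⟨ x , y ⟩                         ≈⟨ ∑-cong (λ j → *-congʳ (x≈ j)) ⟩
      ⟨ comb c g , y ⟩                  ≈⟨ ∑-assoc c g y ⟩
      ∑ (λ l → c l * ⟨ g l , y ⟩)       ≈⟨ ⟨⟩-zeroʳ c y⊥g ⟩
      0#                                ∎

    -- A parity-check matrix; its rows turn out to be a basis of the dual.
    h : Fin (r ∸ k) → Vect r
    h = proj₁ (Whole.kernel g (λ _ _ → tt))

    h-indep : Indep h
    h-indep = proj₁ (proj₂ (proj₂ (Whole.kernel g (λ _ _ → tt))))

    g⊥h : ∀ l i → ⟨ g l , h i ⟩ ≈ 0#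
    g⊥h = proj₂ (proj₂ (proj₂ (Whole.kernel g (λ _ _ → tt))))

    h∈dual : ∀ i → dual C (h i)
    h∈dual i = ⊥g⇒dual (h i) (λ l → g⊥h l i)

    dual⇒⊥g : ∀ y → dual C y → ∀ l → ⟨ g l , y ⟩ ≈ 0#
    dual⇒⊥g y y∈ l = trans (sym (dot≈⟨⟩ (g l) y)) (y∈ (g l) (g∈ l))

    dual-isCode : IsCode (dual C) (r ∸ k)
    dual-isCode = record
      { resp  = λ y z y≈z y∈ x x∈ → trans (dot≈⟨⟩ x z) (trans (∑-cong λ j → *-congˡ (sym (y≈z j))) (trans (sym (dot≈⟨⟩ x y)) (y∈ x x∈)))
      ; zero∈ = λ x x∈ → trans (dot≈⟨⟩ x _) (⟨⟩-zeroʳ x λ _ → refl)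
      ; +∈    = λ y z y∈ z∈ x x∈ → trans (dot≈⟨⟩ x _) (trans (∑-cong λ j → distribˡ _ _ _) (trans (∑-distrib-+ _ _)
                  (trans (+-cong (trans (sym (dot≈⟨⟩ x y)) (y∈ x x∈)) (trans (sym (dot≈⟨⟩ x z)) (z∈ x x∈))) (+-identityˡ _))))
      ; ·∈    = λ a y y∈ x x∈ → trans (dot≈⟨⟩ x _) (trans (⟨⟩-comm x _) (trans (⟨⟩-*ˡ a y x)
                  (*-zeroʳ-≈ (trans (⟨⟩-comm y x) (trans (sym (dot≈⟨⟩ x y)) (y∈ x x∈))))))
      ; dim   = h , h∈dual , (λ c _ c≈0 → h-indep c (λ j → trans (sym (lincomb≈comb c h j)) (c≈0 j)))
                , λ y y∈ → let (c , y≈) = annihilator-spanned h g (ℕₚ.≤-trans (ℕₚ.m≤n+m∸n r k) (ℕₚ.≤-reflexive (ℕₚ.+-comm k _)))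
                                            h-indep g-indep (λ i l → trans (⟨⟩-comm _ _) (g⊥h l i))
                                            y (λ l → trans (⟨⟩-comm _ _) (dual⇒⊥g y y∈ l))
                           in c , (λ _ → tt) , λ j → trans (y≈ j) (sym (lincomb≈comb c h j))
      }

    -- The spanning argument for the dual with the roles of `g` and `h` exchanged.
    dual-dual⇒ : ∀ x → dual (dual C) x → C x
    dual-dual⇒ x x∈ with annihilator-spanned g h (ℕₚ.m≤n+m∸n r k) g-indep h-indep g⊥h x
                           (λ i → trans (⟨⟩-comm _ _) (trans (sym (dot≈⟨⟩ (h i) x)) (x∈ (h i) (h∈dual i))))
    ... | c , x≈ = resp _ _ (sym ∘ x≈) (comb∈ c g g∈)

    dual-dual⇐ : ∀ x → C x → dual (dual C) x
    dual-dual⇐ x x∈ y y∈ = trans (dot≈⟨⟩ y x) (trans (⟨⟩-comm y x) (trans (sym (dot≈⟨⟩ x y)) (y∈ x x∈)))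

    nonzero⇒0<k : ∀ x → C x → NonZero x → 0 < k
    nonzero⇒0<k x x∈ x≉0 with k ℕ.≟ 0
    ... | no  k≢0 = ℕₚ.n≢0⇒n>0 k≢0
    ... | yes k≡0 with coefficients x x∈
    ... | c , x≈ = contradiction (λ j → trans (x≈ j) (∑-zero λ l → ⊥-elim (Finₚ.¬Fin0 (≡.subst Fin k≡0 l)))) x≉0

  NonZero⇒∃ : ∀ {r} {x : Vect r} → NonZero x → ∃ λ j → ¬ (x j ≈ 0#)
  NonZero⇒∃ {x = x} x≉0 with find-nonzero x
  ... | inj₁ found = found
  ... | inj₂ x≈0   = contradiction x≈0 x≉0

  -- The Singleton argument: s > d coefficients suffice to make the last d coordinates vanish, and
  -- the e remaining ones bound the rank.
  low-rank-word : ∀ {r s e d} (h : Fin s → Vect r) → Indep h → r ≡ e ℕ.+ d → d < s →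
                  ∃ λ c → NonZero (comb c h) × ∃ λ w → RankData (comb c h) w × w ≤ e
  low-rank-word {s = s} {e} {d} h ind ≡.refl d<s with Whole.nontrivial d<s (λ i l → h l (e ↑ʳ i)) (λ _ _ → tt)
  ... | c , _ , c≉0 , ker = c , (λ x≈0 → c≉0 (ind c x≈0)) , w , X , rank≤ X R R∈ (λ i → x (i ↑ˡ d)) x≈R
    where
    x = comb c h
    w = proj₁ (rankData x)
    X = proj₂ (rankData x)
    R : Fin (e ℕ.+ d) → Vect e
    R j = [ δ , (λ _ → 0ᵥ) ]′ (splitAt e j)
    R∈ : ∀ j l → F (R j l)
    R∈ j l with splitAt e j
    ... | inj₁ i = δ∈ i l
    ... | inj₂ i = 0∈
    x≈R : ∀ j → x j ≈ ⟨ R j , (λ i → x (i ↑ˡ d)) ⟩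
    x≈R j with splitAt e j in eq
    ... | inj₁ i = trans (reflexive (≡.cong x (≡.sym (Finₚ.splitAt⁻¹-↑ˡ eq)))) (sym (∑-δˡ (λ i → x (i ↑ˡ d)) i))
    ... | inj₂ i = trans (reflexive (≡.cong x (≡.sym (Finₚ.splitAt⁻¹-↑ʳ {m = e} eq)))) (trans (trans (∑-cong λ l → *-comm _ _) (ker i)) (sym (⟨⟩-zeroˡ _ λ _ → refl)))

  -- The weight duality for a partition with a single block gives the lower bound k + 1 = r - (r -
  -- k) + 1; the Singleton argument shows that it is attained.
  dual-MRD : ∀ {r k} {C : Code r} → k < r → IsMRD C k → IsMRD (dual C) (r ∸ k)
  dual-MRD {r} {k} {C} k<r (code , far , _) = dual-isCode , ≡.subst (λ d → HasMinDist (dual C) (suc d)) (≡.sym (ℕₚ.m∸[m∸n]≡n (ℕₚ.<⇒≤ k<r))) (dual-far , attained)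
    where
    open LinearCode code
    open Blocks {r} {k} {1} (λ _ → zero) (λ _ → zero)
    weights : ∀ J α w → Supports J (comb α g) → Nonempty J → RankData (comb α g) w → suc (count {r} (λ _ → J zero)) ≤ w ℕ.+ count {k} (λ _ → J zero)
    weights J α w (_ , on) (zero , J₀) X with on zero J₀
    ... | j , _ , xj≉0 = ≡.subst₂ (λ a b → suc a ≤ w ℕ.+ b) (≡.sym (count-true {r} λ _ → J₀)) (≡.sym (count-true {k} λ _ → J₀))
                           (suc-∸-≤ (far _ (comb∈ α g g∈) (λ x≈0 → xj≉0 (x≈0 j)) w (fromRankData X)))
    dual-far : ∀ y → dual C y → NonZero y → ∀ w → HasRankWeight y w → suc k ≤ w
    dual-far y y∈ y≉0 w W = ≡.subst (λ a → suc a ≤ w) (count-true {k} {λ _ → true} λ _ → ≡.refl)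
      (Duality.dual-weights g g-indep (λ l j ne → contradiction ≡.refl ne) weights
        (λ _ → true) y w (dual⇒⊥g y y∈)
        ((λ _ ()) , λ { zero _ → let (j , yj≉0) = NonZero⇒∃ y≉0 in j , ≡.refl , yj≉0 }) (zero , ≡.refl) (toRankData W))
    attained : ∃ λ y → dual C y × NonZero y × HasRankWeight y (suc k)
    -- The dual has dimension r - k, one more than the r - (k + 1) coordinates to be cleared, which
    -- leaves k + 1 of them.
    attained with low-rank-word h h-indep (≡.sym (ℕₚ.m+[n∸m]≡n k<r)) (ℕₚ.∸-monoʳ-< (ℕₚ.n<1+n k) k<r)
    ... | c , y≉0 , w , Y , w≤ = comb c h , y∈ , y≉0 , ≡.subst (HasRankWeight (comb c h)) (ℕₚ.≤-antisym w≤ (dual-far _ y∈ y≉0 w (fromRankData Y))) (fromRankData Y)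
      where
      y∈ : dual C (comb c h)
      y∈ = LinearCode.comb∈ dual-isCode c h h∈dual

  ⟨++⟩ : ∀ {a b} (x x′ : Vect a) (y y′ : Vect b) → ⟨ x ++ y , x′ ++ y′ ⟩ ≈ ⟨ x , x′ ⟩ + ⟨ y , y′ ⟩
  ⟨++⟩ {a} x x′ y y′ = trans (∑-split a _) (+-cong
    (∑-cong λ i → reflexive (≡.cong₂ _*_ (Vectorₚ.lookup-++ˡ x y i) (Vectorₚ.lookup-++ˡ x′ y′ i)))
    (∑-cong λ i → reflexive (≡.cong₂ _*_ (Vectorₚ.lookup-++ʳ x y i) (Vectorₚ.lookup-++ʳ x′ y′ i))))

  module _ {t} (n : Vec ℕ t) where

    placeAt : ∀ i → Vect (lookup n i) → ∀ i′ → Vect (lookup n i′)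
    placeAt i v i′ with i Fin.≟ i′
    ... | yes ≡.refl = v
    ... | no  _      = 0ᵥ

    place : ∀ i → Vect (lookup n i) → Vect (sum n)
    place i v = collect n (placeAt i v)

    place-on : ∀ i v j → place i v (embed n i j) ≡ v j
    place-on i v j = ≡.trans (collect-embed n (placeAt i v) i j) same
      where
      same : placeAt i v i j ≡ v j
      same with i Fin.≟ i
      ... | yes ≡.refl = ≡.refl
      ... | no  i≢i    = contradiction ≡.refl i≢i

    place-off : ∀ i v {i′} j → i ≢ i′ → place i v (embed n i′ j) ≡ 0#
    place-off i v {i′} j i≢i′ = ≡.trans (collect-embed n (placeAt i v) i′ j) zeros
      where
      zeros : placeAt i v i′ j ≡ 0#
      zeros with i Fin.≟ i′
      ... | yes i≡i′ = contradiction i≡i′ i≢i′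
      ... | no  _    = ≡.refl

    by-blocks : (P : Fin (sum n) → Set) → (∀ i j → P (embed n i j)) → ∀ j → P j
    by-blocks P Pij j with embed-onto n j
    ... | i , j′ , ≡.refl = Pij i j′

    by-place : ∀ i (P : Fin (sum n) → Set) → (∀ j → P (embed n i j)) → (∀ {i′} j → i ≢ i′ → P (embed n i′ j)) → ∀ j → P j
    by-place i P on off = by-blocks P λ i′ j → on-off i′ j
      where
      on-off : ∀ i′ j → P (embed n i′ j)
      on-off i′ j with i Fin.≟ i′
      ... | yes ≡.refl = on j
      ... | no  i≢i′   = off j i≢i′

    ⟨⟩-blocks : ∀ x y → ⟨ x , y ⟩ ≈ ∑ (λ i → ⟨ block n x i , block n y i ⟩)
    ⟨⟩-blocks x y = ∑-embed n _

    ⟨place⟩ : ∀ i v y → ⟨ place i v , y ⟩ ≈ ⟨ v , block n y i ⟩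
    ⟨place⟩ i v y = begin
      ⟨ place i v , y ⟩                                          ≈⟨ ⟨⟩-blocks (place i v) y ⟩
      ∑ (λ i′ → ⟨ block n (place i v) i′ , block n y i′ ⟩)       ≈⟨ ∑-single _ i (λ i′ i′≢i → ⟨⟩-zeroˡ _ λ j → reflexive (place-off i v j (i′≢i ∘ ≡.sym))) ⟩
      ⟨ block n (place i v) i , block n y i ⟩                    ≈⟨ ∑-cong (λ j → *-congʳ (reflexive (place-on i v j))) ⟩
      ⟨ v , block n y i ⟩                                        ∎

  -- Duals of direct sums of MRD codes

  module BlockCode {t} (n k : Vec ℕ t) {C : Code (sum n)} (code : IsCode C (sum k))
                   (Cs : ∀ i → Code (lookup n i)) (mrd : ∀ i → IsMRD (Cs i) (lookup k i))
                   (split : ∀ x → (C x → ∀ i → Cs i (block n x i)) × ((∀ i → Cs i (block n x i)) → C x))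
                   (far : ∀ x → C x → (∀ i → NonZero (block n x i)) → ∀ w → HasRankWeight x w → suc (sum n ∸ sum k) ≤ w)
                   (k<n : ∀ i → lookup k i < lookup n i) where

    open Blocks (blk n) (blk k)
    private module Cᵢ i = LinearCode (proj₁ (mrd i))
    open LinearCode code using (comb∈)

    place∈ : ∀ i v → Cs i v → C (place n i v)
    place∈ i v v∈ = proj₂ (split _) blocks∈
      where
      blocks∈ : ∀ i′ → Cs i′ (block n (place n i v) i′)
      blocks∈ i′ with i Fin.≟ i′
      ... | yes ≡.refl = Cᵢ.resp i _ _ (λ j → sym (reflexive (place-on n i v j))) v∈
      ... | no  i≢i′   = Cᵢ.resp i′ _ _ (λ j → sym (reflexive (place-off n i v j i≢i′))) (Cᵢ.zero∈ i′)

    -- One direction tests `y` on words placed in a single block; the other sums the pairings over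
    -- the blocks.
    dual-split : ∀ y → (dual C y → ∀ i → dual (Cs i) (block n y i)) × ((∀ i → dual (Cs i) (block n y i)) → dual C y)
    dual-split y = (λ y∈ i v v∈ → trans (dot≈⟨⟩ v _) (trans (sym (⟨place⟩ n i v y)) (trans (sym (dot≈⟨⟩ _ y)) (y∈ _ (place∈ i v v∈)))))
                 , λ ys∈ x x∈ → trans (dot≈⟨⟩ x y) (trans (⟨⟩-blocks n x y) (∑-zero λ i → trans (sym (dot≈⟨⟩ _ _)) (ys∈ i _ (proj₁ (split x) x∈ i))))

    -- Block-diagonal generators replace the basis that comes with `code`, whose elements may mix
    -- blocks.
    g : Fin (sum k) → Vect (sum n)
    g = collect k (λ i l → place n i (Cᵢ.g i l))

    g-embed : ∀ i l → g (embed k i l) ≡ place n i (Cᵢ.g i l)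
    g-embed = collect-embed k (λ i l → place n i (Cᵢ.g i l))

    g∈ : ∀ l → C (g l)
    g∈ = by-blocks k _ λ i l → ≡.subst C (≡.sym (g-embed i l)) (place∈ i _ (Cᵢ.g∈ i l))

    g-block : ∀ l j → blk n j ≢ blk k l → g l j ≈ 0#
    g-block = by-blocks k _ λ i l → by-blocks n _ λ i′ j ne →
      trans (reflexive (≡.cong (λ v → v (embed n i′ j)) (g-embed i l)))
            (reflexive (place-off n i _ j λ i≡i′ → ne (≡.trans (blk-embed n i′ j) (≡.trans (≡.sym i≡i′) (≡.sym (blk-embed k i l))))))

    g-indep : Indep g
    g-indep c c≈0 = by-blocks k _ λ i → Cᵢ.g-indep i (λ l → c (embed k i l)) λ j → begin
      ∑ (λ l → c (embed k i l) * Cᵢ.g i l j)                                    ≈⟨ ∑-cong (λ l → *-congˡ (reflexive (≡.trans (≡.cong (λ v → v (embed n i j)) (g-embed i l)) (place-on n i _ j)))) ⟨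
      ∑ (λ l → c (embed k i l) * g (embed k i l) (embed n i j))                 ≈⟨ ∑-single _ i (λ i′ i′≢i → ∑-zero λ l → *-zeroʳ-≈ (g-block (embed k i′ l) (embed n i j) λ eq → i′≢i (≡.trans (≡.sym (blk-embed k i′ l)) (≡.trans (≡.sym eq) (blk-embed n i j))))) ⟨
      ∑ (λ i′ → ∑ (λ l → c (embed k i′ l) * g (embed k i′ l) (embed n i j)))    ≈⟨ ∑-embed k _ ⟨
      comb c g (embed n i j)                                                    ≈⟨ c≈0 _ ⟩
      0#                                                                        ∎

    block-nonzero : ∀ {J x} → Supports J x → ∀ i → J i ≡ true → NonZero (block n x i)
    block-nonzero (_ , on) i Ji x≈0 with on i Ji
    ... | j , bj≡i , xj≉0 with embed-onto n j
    ... | i′ , j′ , ≡.refl with ≡.trans (≡.sym (blk-embed n i′ j′)) bj≡i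
    ... | ≡.refl = xj≉0 (x≈0 j′)

    -- A zero block i of x is filled with a minimum weight word of Cs i, scaled so that its span
    -- meets the span of x: the weight then grows by at most nᵢ − kᵢ.
    module Fill (J : Fin t → Bool) (x : Vect (sum n)) (w : ℕ) (x∈ : C x) (x-supp : Supports J x)
                (J≠∅ : Nonempty J) (X : RankData x w) (i : Fin t) (Ji : J i ≡ false) where

      word : ∃ λ d → Cs i d × NonZero d × HasRankWeight d (suc (lookup n i ∸ lookup k i))
      word = proj₂ (proj₂ (mrd i))

      d : Vect (lookup n i)
      d = proj₁ word

      module D = RankData (toRankData (proj₂ (proj₂ (proj₂ word))))
      module X = RankData X

      b₀≉0 : ¬ (D.basis zero ≈ 0#)
      b₀≉0 b₀≈0 = 0≉1 (sym (trans (sym (δ-refl (zero {lookup n i ∸ lookup k i}))) (D.indep (δ zero) (δ∈ zero) (trans (∑-δˡ D.basis zero) b₀≈0) zero)))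

      entry : ∃ λ j → ¬ (x j ≈ 0#)
      entry with proj₂ x-supp (proj₁ J≠∅) (proj₂ J≠∅)
      ... | j , _ , xj≉0 = j , xj≉0

      j₀ : Fin (sum n)
      j₀ = proj₁ entry

      z scale : Carrier
      z = proj₁ (inverse _ b₀≉0)
      -- The first basis element of the scaled word becomes the entry `x j₀`, so only nᵢ - kᵢ of its
      -- nᵢ - kᵢ + 1 basis elements are new.
      scale = x j₀ * z

      scale-b₀ : scale * D.basis zero ≈ x j₀
      scale-b₀ = trans (*-assoc _ _ _) (trans (*-congˡ (trans (*-comm _ _) (proj₂ (inverse _ b₀≉0)))) (*-identityʳ _))

      scale≉0 : ¬ (scale ≈ 0#)
      scale≉0 s≈0 = proj₂ entry (trans (sym scale-b₀) (*-zeroˡ-≈ s≈0))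

      filling x⁺ : Vect (sum n)
      filling = place n i (scale ·ᵥ d)
      x⁺ = x +ᵥ filling

      x⁺∈ : C x⁺
      x⁺∈ = IsCode.+∈ code _ _ x∈ (place∈ i _ (Cᵢ.·∈ i scale d (proj₁ (proj₂ word))))

      adjoin-self : adjoin J i i ≡ true
      adjoin-self with i Fin.≟ i
      ... | yes _   = Boolₚ.∨-zeroʳ (J i)
      ... | no  i≢i = contradiction ≡.refl i≢i

      x⁺-off : ∀ {i′} → i ≢ i′ → ∀ j → x⁺ (embed n i′ j) ≈ x (embed n i′ j)
      x⁺-off i≢i′ j = trans (+-congˡ (reflexive (place-off n i _ j i≢i′))) (+-identityʳ _)

      x⁺-on : ∀ j → x⁺ (embed n i j) ≈ scale * d j
      x⁺-on j = trans (+-cong (proj₁ x-supp _ (≡.trans (≡.cong J (blk-embed n i j)) Ji)) (reflexive (place-on n i _ j))) (+-identityˡ _)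

      x⁺-supp : Supports (adjoin J i) x⁺
      x⁺-supp = by-place n i _
          (λ j eq → contradiction (≡.trans (≡.sym adjoin-self) (≡.trans (≡.cong (adjoin J i) (≡.sym (blk-embed n i j))) eq)) λ ())
          (λ j i≢i′ eq → trans (x⁺-off i≢i′ j) (proj₁ x-supp _ (Boolₚ.∨-conicalˡ _ _ eq)))
        , on
        where
        on : ∀ i′ → adjoin J i i′ ≡ true → ∃ λ j → blk n j ≡ i′ × ¬ (x⁺ j ≈ 0#)
        on i′ eq with i′ Fin.≟ i
        ... | yes ≡.refl = let (j , dj≉0) = NonZero⇒∃ (proj₁ (proj₂ (proj₂ word))) in
              embed n i j , blk-embed n i j , λ x⁺≈0 → dj≉0 (*-cancel-0 scale≉0 (trans (sym (x⁺-on j)) x⁺≈0))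
        ... | no  i′≢i with proj₂ x-supp i′ (≡.trans (≡.sym (Boolₚ.∨-identityʳ (J i′))) eq)
        ... | j , bj≡i′ , xj≉0 with embed-onto n j
        ... | i″ , j′ , ≡.refl = embed n i″ j′ , bj≡i′ , λ x⁺≈0 → xj≉0 (trans (sym (x⁺-off (λ i≡i″ → i′≢i (≡.trans (≡.sym bj≡i′) (≡.trans (blk-embed n i″ j′) (≡.sym i≡i″)))) j′)) x⁺≈0)

      w⁺ : ℕ
      w⁺ = proj₁ (rankData x⁺)

      P : Fin (suc (lookup n i ∸ lookup k i)) → Vect (sum n)
      P l = place n i (λ j → D.P j l)

      P∈ : ∀ l j → F (P l j)
      P∈ l = by-place n i _ (λ j → ≡.subst F (≡.sym (place-on n i _ j)) (D.P∈ j l)) (λ j i≢i′ → ≡.subst F (≡.sym (place-off n i _ j i≢i′)) 0∈)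

      filling≈ : ∀ j → filling j ≈ P zero j * x j₀ + ∑ (λ l → P (suc l) j * (scale * D.basis (suc l)))
      filling≈ j = begin
        filling j                                                                              ≈⟨ expand j ⟩
        ∑ (λ l → P l j * (scale * D.basis l))                                                  ≈⟨ ∑-suc _ ⟩
        P zero j * (scale * D.basis zero) + ∑ (λ l → P (suc l) j * (scale * D.basis (suc l)))  ≈⟨ +-congʳ (*-congˡ scale-b₀) ⟩
        P zero j * x j₀ + ∑ (λ l → P (suc l) j * (scale * D.basis (suc l)))                    ∎
        where
        expand : ∀ j → filling j ≈ ∑ (λ l → P l j * (scale * D.basis l))
        expand = by-place n i _
          (λ j → begin
            filling (embed n i j)                              ≈⟨ reflexive (place-on n i _ j) ⟩
            scale * d j                                        ≈⟨ *-congˡ (D.x≈ j) ⟩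
            scale * ∑ (λ l → D.P j l * D.basis l)              ≈⟨ *-distribˡ-∑ scale _ ⟩
            ∑ (λ l → scale * (D.P j l * D.basis l))            ≈⟨ ∑-cong (λ l → trans (sym (*-assoc _ _ _)) (trans (*-congʳ (*-comm _ _)) (*-assoc _ _ _))) ⟩
            ∑ (λ l → D.P j l * (scale * D.basis l))            ≈⟨ ∑-cong (λ l → *-congʳ (reflexive (place-on n i _ j))) ⟨
            ∑ (λ l → P l (embed n i j) * (scale * D.basis l))  ∎)
          (λ j i≢i′ → trans (reflexive (place-off n i _ j i≢i′)) (sym (∑-zero λ l → *-zeroˡ-≈ (reflexive (place-off n i _ j i≢i′)))))

      w⁺≤ : w⁺ ≤ w ℕ.+ (lookup n i ∸ lookup k i)
      w⁺≤ = rank≤ (proj₂ (rankData x⁺)) (λ j → R j ++ (λ l → P (suc l) j)) (λ j → R∈ j) (X.basis ++ (λ l → scale * D.basis (suc l))) x⁺≈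
        where
        -- The shared element `x j₀` is rewritten in the basis of `x`, so its column is absorbed
        -- here and needs none of its own.
        R : Fin (sum n) → Vect w
        R j l = X.P j l + P zero j * X.P j₀ l
        R∈ : ∀ j l → F ((R j ++ (λ l → P (suc l) j)) l)
        R∈ j l with splitAt w l
        ... | inj₁ l₁ = +∈ _ _ (X.P∈ j l₁) (*∈ _ _ (P∈ zero j) (X.P∈ j₀ l₁))
        ... | inj₂ l₂ = P∈ (suc l₂) j
        x⁺≈ : ∀ j → x⁺ j ≈ ⟨ R j ++ (λ l → P (suc l) j) , X.basis ++ (λ l → scale * D.basis (suc l)) ⟩
        x⁺≈ j = begin
          x j + filling j                                                                 ≈⟨ +-congˡ (filling≈ j) ⟩
          x j + (P zero j * x j₀ + rest)                                                  ≈⟨ +-assoc _ _ _ ⟨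
          x j + P zero j * x j₀ + rest                                                    ≈⟨ +-congʳ (+-cong (X.x≈ j) (*-congˡ (X.x≈ j₀))) ⟩
          ⟨ X.P j , X.basis ⟩ + P zero j * ⟨ X.P j₀ , X.basis ⟩ + rest                    ≈⟨ +-congʳ (⟨⟩-+*ˡ _ _ _ _) ⟨
          ⟨ R j , X.basis ⟩ + rest                                                        ≈⟨ ⟨++⟩ (R j) X.basis _ _ ⟨
          ⟨ R j ++ (λ l → P (suc l) j) , X.basis ++ (λ l → scale * D.basis (suc l)) ⟩     ∎
          where rest = ∑ (λ l → P (suc l) j * (scale * D.basis (suc l)))

      conclude : suc (count (adjoin J i ∘ blk n)) ≤ w⁺ ℕ.+ count (adjoin J i ∘ blk k) →
                 suc (count (J ∘ blk n)) ≤ w ℕ.+ count (J ∘ blk k)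
      conclude le = fill-arithmetic (ℕₚ.<⇒≤ (k<n i)) w⁺≤
        (≡.subst₂ (λ a b → suc a ≤ w⁺ ℕ.+ b) (count-adjoin n J i Ji) (count-adjoin k J i Ji) le)

    -- Zero blocks are filled one at a time, with `s` bounding their number, until `far` applies.
    weights′ : ∀ s J x w → count (not ∘ J) < s → C x → Supports J x → Nonempty J → RankData x w →
               suc (count (J ∘ blk n)) ≤ w ℕ.+ count (J ∘ blk k)
    weights′ (suc s) J x w (s≤s |Jᶜ|≤s) x∈ x-supp J≠∅ X with Finₚ.any? (λ i → J i Bool.≟ false)
    ... | no  full = ≡.subst₂ (λ a b → suc a ≤ w ℕ.+ b) (≡.sym (count-true (all-true ∘ blk n))) (≡.sym (count-true (all-true ∘ blk k)))
                       (suc-∸-≤ (far x x∈ (λ i → block-nonzero x-supp i (all-true i)) w (fromRankData X)))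
      where
      all-true : ∀ i → J i ≡ true
      all-true i = Boolₚ.¬-not λ Ji → full (i , Ji)
    ... | yes (i , Ji) = conclude (weights′ s (adjoin J i) x⁺ w⁺
              (ℕₚ.≤-trans (count-mono-< fewer i (≡.cong not adjoin-self) (≡.cong not Ji)) |Jᶜ|≤s)
              x⁺∈ x⁺-supp (i , adjoin-self) (proj₂ (rankData x⁺)))
      where
      open Fill J x w x∈ x-supp J≠∅ X i Ji
      fewer : ∀ i′ → not (adjoin J i i′) ≡ true → not (J i′) ≡ true
      fewer i′ eq with J i′
      ... | false = ≡.refl
      ... | true  = eq

    weights : ∀ J α w → Supports J (comb α g) → Nonempty J → RankData (comb α g) w →
              suc (count (J ∘ blk n)) ≤ w ℕ.+ count (J ∘ blk k)
    weights J α w = weights′ _ J (comb α g) w ℕₚ.≤-refl (comb∈ α g g∈)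

    -- The index `i₀` shows that the full set of blocks is nonempty.
    dual-far : Fin t → ∀ y → dual C y → (∀ i → NonZero (block n y i)) → ∀ w → HasRankWeight y w → suc (sum k) ≤ w
    dual-far i₀ y y∈ ys≉0 w W = ≡.subst (λ a → suc a ≤ w) (count-true {P = λ (_ : Fin (sum k)) → true} λ _ → ≡.refl)
      (Duality.dual-weights g g-indep g-block weights (λ _ → true) y w
        (λ l → trans (sym (dot≈⟨⟩ (g l) y)) (y∈ (g l) (g∈ l)))
        ((λ _ ()) , λ i _ → let (j , yj≉0) = NonZero⇒∃ (ys≉0 i) in embed n i j , blk-embed n i j , yj≉0)
        (i₀ , ≡.refl) (toRankData W))

  dual-blockMRD : ∀ {t} (n k : Vec ℕ t) {C : Code (sum n)} → IsBlockMRD n k C → IsBlockMRD n (zipWith _∸_ n k) (dual C)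
  dual-blockMRD {t} n k {C} (k<n , code , Cs , mrd , split , far) =
      (λ i → ≡.subst (_< lookup n i) (≡.sym (lookup-∸ i)) (ℕₚ.∸-monoʳ-< (0<k i) (ℕₚ.<⇒≤ (k<n i))))
    , ≡.subst (IsCode (dual C)) (≡.trans (≡.cong (_∸ sum k) (≡.sym total)) (ℕₚ.m+n∸n≡m _ (sum k))) (LinearCode.dual-isCode code)
    , (λ i → dual (Cs i))
    , (λ i → ≡.subst (IsMRD (dual (Cs i))) (≡.sym (lookup-∸ i)) (dual-MRD (k<n i) (mrd i)))
    , dual-split
    , λ y y∈ ys≉0 w W → ≡.subst (λ a → suc a ≤ w) (≡.sym (≡.trans (≡.cong (_∸ sum (zipWith _∸_ n k)) (≡.sym total)) (ℕₚ.m+n∸m≡n (sum (zipWith _∸_ n k)) (sum k)))) (dual-far′ n k code far dual-far y y∈ ys≉0 w W)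
    where
    open BlockCode n k code Cs mrd split far k<n
    total : sum (zipWith _∸_ n k) ℕ.+ sum k ≡ sum n
    total = sum-zipWith-∸ n k (ℕₚ.<⇒≤ ∘ k<n)
    lookup-∸ : ∀ i → lookup (zipWith _∸_ n k) i ≡ lookup n i ∸ lookup k i
    lookup-∸ i = Vecₚ.lookup-zipWith _∸_ i n k
    -- The attained minimum distance supplies a nonzero word in each block code; this is what makes
    -- nᵢ - kᵢ < nᵢ strict.
    0<k : ∀ i → 0 < lookup k i
    0<k i with proj₂ (proj₂ (mrd i))
    ... | x , x∈ , x≉0 , _ = LinearCode.nonzero⇒0<k (proj₁ (mrd i)) x x∈ x≉0
    -- For t = 0 no block is available, but then the hypothesis on C fails at the empty word.
    dual-far′ : ∀ {t} (n k : Vec ℕ t) {C : Code (sum n)} → IsCode C (sum k) →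
      (∀ x → C x → (∀ i → NonZero (block n x i)) → ∀ w → HasRankWeight x w → suc (sum n ∸ sum k) ≤ w) →
      (Fin t → ∀ y → dual C y → (∀ i → NonZero (block n y i)) → ∀ w → HasRankWeight y w → suc (sum k) ≤ w) →
      ∀ y → dual C y → (∀ i → NonZero (block n y i)) → ∀ w → HasRankWeight y w → suc (sum k) ≤ w
    dual-far′ []      []      code far _        y _ ys≉0 w W = far y (IsCode.resp code _ y (λ ()) (IsCode.zero∈ code)) ys≉0 w W
    dual-far′ (_ ∷ _) (_ ∷ _) code far dual-far = dual-far zero

  -- The forward direction applied to the dual, using n - (n - k) = k and the fact that the double
  -- dual is C.
  dual-blockMRD⁻¹ : ∀ {t} (n k : Vec ℕ t) {C : Code (sum n)} → (∀ i → lookup k i < lookup n i) → IsCode C (sum k) →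
                    IsBlockMRD n (zipWith _∸_ n k) (dual C) → IsBlockMRD n k C
  dual-blockMRD⁻¹ n k {C} k<n code D-mrd
    with ≡.subst (λ a → IsBlockMRD n a (dual (dual C))) (zipWith-∸-involutive n k (ℕₚ.<⇒≤ ∘ k<n)) (dual-blockMRD n (zipWith _∸_ n k) D-mrd)
  ... | _ , _ , Cs , mrd , split , far =
      k<n , code , Cs , mrd
    , (λ x → proj₁ (split x) ∘ dual-dual⇐ x , dual-dual⇒ x ∘ proj₂ (split x))
    , λ x x∈ → far x (dual-dual⇐ x x∈)
    where open LinearCode code

theorem2p28 : (L : Field) (F : Field.Carrier L → Set) (q m : ℕ)
    → IsExtension L F q m
    → (t : ℕ) (n k : Vec ℕ t)
    → (∀ i → lookup k i < lookup n i)
    → (∀ i → lookup n i ≤ m)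
    → (C : FieldExtension.Code L F (sum n))
    → FieldExtension.IsCode L F C (sum k)
    → (FieldExtension.IsBlockMRD L F n k C
    → FieldExtension.IsBlockMRD L F n (zipWith _∸_ n k) (FieldExtension.dual L F C))
    × (FieldExtension.IsBlockMRD L F n (zipWith _∸_ n k) (FieldExtension.dual L F C)
    → FieldExtension.IsBlockMRD L F n k C)
theorem2p28 L F q m ext t n k k<n _ C code = dual-blockMRD n k , dual-blockMRD⁻¹ n k k<n code
  where
  open IsExtension ext using (subfield; card)
  open Codes L (decidable-≈ ext) F subfield q card
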